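{- Let $\mathbb{F}_q$ be a finite field, let $k,m\ge 2$ and $n\ge 3$ be integers with $\operatorname{char}(\mathbb{F}_q)\nmid mk$ and $n<mk$, and let $a,b,a_1,\dots,a_n\in\mathbb{F}_q^*$. Let $N$ be the number of solutions $(x_1,\dots,x_n)\in\mathbb{F}_q^n$ of $$(a_1X_1^m+\cdots+a_nX_n^m+a)^k=bX_1\cdots X_n.$$ Then $$\big|N-q^{n-1}\big|\le 9\,(mk)^{\max\{n-1,4\}}\,q^{n-3/2}.$$ -}

module Defs where

open import Level using (Level; _⊔_) renaming (suc to lsuc)
open import Data.Nat using (ℕ; zero; suc)
open import Data.Fin using (Fin; zero; suc)
open import Data.Bool using (Bool; true; false; if_then_else_)
open import Data.Product using (Σ; _,_)
open import Data.List using (List; map; allFin)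
open import Data.Nat.ListAction using (sum)
open import Relation.Nullary using (¬_; does)
open import Relation.Binary.PropositionalEquality using (_≡_)
open import Relation.Binary.Definitions using (Decidable)
open import Algebra.Bundles using (CommutativeRing)

record Field (c ℓ : Level) : Set (lsuc (c ⊔ ℓ)) where
  field
    commRing : CommutativeRing c ℓ
  open CommutativeRing commRing public
  field
    1≉0     : ¬ (1# ≈ 0#)
    inverse : ∀ x → ¬ (x ≈ 0#) → Σ Carrier (λ y → (x * y) ≈ 1#)

record FiniteField (c ℓ : Level) : Set (lsuc (c ⊔ ℓ)) where
  field
    fld : Field c ℓ
  open Field fld public
  field
    q        : ℕ
    elem     : Fin q → Carrier
    elem-inj : ∀ i j → elem i ≈ elem j → i ≡ j
    elem-sur : ∀ x → Σ (Fin q) (λ i → elem i ≈ x)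
    _≟_      : Decidable _≈_

module FieldOps {c ℓ : Level} (F : FiniteField c ℓ) where
  open FiniteField F hiding (zero)

  pow : Carrier → ℕ → Carrier
  pow x zero    = 1#
  pow x (suc n) = x * pow x n

  natCast : ℕ → Carrier
  natCast zero    = 0#
  natCast (suc n) = 1# + natCast n

  sumF : ∀ n → (Fin n → Carrier) → Carrier
  sumF zero    f = 0#
  sumF (suc n) f = f zero + sumF n (λ i → f (suc i))

  prodF : ∀ n → (Fin n → Carrier) → Carrier
  prodF zero    f = 1#
  prodF (suc n) f = f zero * prodF n (λ i → f (suc i))

  -- number of tuples (x₁,…,xₙ) ∈ F_q^n satisfying P (P decidable);
  -- tuples are enumerated as f : Fin n → Fin q via elem.
  consF : ∀ {n} → Fin q → (Fin n → Fin q) → Fin (suc n) → Fin q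
  consF i f zero    = i
  consF i f (suc j) = f j

  countTuples : ∀ n → ((Fin n → Fin q) → Bool) → ℕ
  countTuples zero    P = if P (λ ()) then 1 else 0
  countTuples (suc n) P = sum (map (λ i → countTuples n (λ f → P (consF i f))) (allFin q))

  numSolutions : (n m k : ℕ) (a b : Carrier) (as : Fin n → Carrier) → ℕ
  numSolutions n m k a b as =
    countTuples n (λ f →
      let x = λ i → elem (f i) in
      does (pow (sumF n (λ i → as i * pow (x i) m) + a) k ≟ (b * prodF n x)))

{-# OPTIONS --safe #-}
module Submission where

-- A second-moment argument.  Let N(A , B) count the solutions x of
-- (A₁x₁ᵐ + … + Aₙxₙᵐ + a)ᵏ = B x₁⋯xₙ, and let V be the sum of (N(A , B) − qⁿ⁻¹)²
-- over all A ∈ Fⁿ and B ∈ F.  Expanding the square, V is governed by the number of (A , B)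
-- for which given x and y are both solutions.  If the vectors (xᵢᵐ) and (yᵢᵐ) are linearly
-- independent, the two linear forms are jointly uniform, and summed over all x, y this
-- contribution cancels the main term exactly.  The dependent pairs are few, so that
-- V ≤ m³ (k + n + 2) q³ⁿ⁻³.  Substituting tᵢxᵢ for xᵢ shows N(Aᵢtᵢᵐ , B t₁⋯tₙ) = N(A , B) for
-- t ∈ (F*)ⁿ, so the term of the given coefficients occurs at least (q − 1)ⁿ / mⁿ times in V;
-- this gives (N − qⁿ⁻¹)² ≤ 2ⁿ mⁿ⁺³ (k + n + 2) q²ⁿ⁻³.

open import Defs
open import Level using (Level; 0ℓ)
open import Data.Nat using (ℕ; zero; suc; _+_; _*_; _∸_; _^_; _≤_; _<_; _⊔_; ∣_-_∣; z≤n; s≤s; NonZero)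
open import Data.Nat.Properties
open import Data.Nat.ListAction using (sum)
open import Data.Nat.ListAction.Properties using (sum-++)
open import Data.Nat.Tactic.RingSolver using (solve-∀)
open import Data.Fin using (Fin; zero; suc)
open import Data.Fin.Properties using (any?; nonZeroIndex) renaming (_≟_ to _≟ᶠ_)
open import Data.List using (List; []; _∷_; _++_; map; length; allFin; tabulate; cartesianProductWith)
open import Data.List.Properties using (map-tabulate; map-++; map-∘; length-tabulate)
open import Data.Vec using (Vec; []; _∷_; replicate) renaming (map to mapᵛ; zipWith to zipWithᵛ; tabulate to tabulateᵛ)
open import Data.Vec.Properties using (≡-dec; ∷-injective)
open import Data.Vec.Relation.Unary.Any using (Any; here; there)
open import Data.Vec.Relation.Unary.All using (All; []; _∷_; all?)
open import Data.Bool using (Bool; if_then_else_)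
open import Data.Product using (Σ; ∃; _,_; proj₁; proj₂)
open import Data.Sum using (_⊎_; inj₁; inj₂)
open import Data.Empty using (⊥-elim)
open import Function using (_∘_)
open import Relation.Nullary using (¬_; Dec; yes; no; does)
open import Relation.Nullary.Decidable using (¬?)
open import Relation.Binary.PropositionalEquality
open import Algebra.Structures using (IsCommutativeRing)
open import Algebra.Bundles using (CommutativeRing; RawRing)
open import Algebra.Morphism.Structures using (IsRingMonomorphism)
import Algebra.Morphism.RingMonomorphism as RingMonomorphism
import Algebra.Properties.Group as GroupProperties
import Algebra.Solver.Ring.NaturalCoefficients.Default as SemiringSolver

-- Averaging over the whole coefficient space takes the place of character sums: a nonzero linear
-- form with uniform coefficients is exactly equidistributed, so permutations of the field suffice.
-- `B` has to vary with `A`, because rescaling the variables moves both. Origin of `k + n + 2`: a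
-- dependent pair, with ratio `c` of its power vectors, normally leaves at most k choices of (value
-- of the form, `B`). It may leave q of them when `c` is 1, one ratio in q, or when the product of
-- the coordinates of x vanishes, at most n vectors in q. On average these exceptions cost 1 and n.
-- The last 1 pays for x = 0, which is missing from the mean. Origin of m³: bounding each fibre of
-- the power map by mⁿ would put m²ⁿ into the result, above the exponent of m that is allowed for n
-- ≥ 5. Spending qⁿ⁻³ on all but three coordinates gives mⁿ⁺³ and exactly q²ⁿ⁻³. Every estimate
-- stays in ℕ: denominators are cleared by powers of q, negative terms are moved across, and the
-- theorem itself is squared, so that 81 = 9² and q²ⁿ⁻³ is the square of the half-integral power.

private variable
  ℓ₁ ℓ₂ : Level
  P : Set ℓ₁
  Q : Set ℓ₂
  S T U : Set
  f g : T → ℕ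

-- Finite sums

∑ : List T → (T → ℕ) → ℕ
∑ xs f = sum (map f xs)

infix 8 ∑
syntax ∑ xs (λ x → e) = ∑[ x ∈ xs ] e

∑-cong : (xs : List T) → (∀ x → f x ≡ g x) → ∑ xs f ≡ ∑ xs g
∑-cong []       p = refl
∑-cong (x ∷ xs) p = cong₂ _+_ (p x) (∑-cong xs p)

∑-mono : (xs : List T) → (∀ x → f x ≤ g x) → ∑ xs f ≤ ∑ xs g
∑-mono []       p = z≤n
∑-mono (x ∷ xs) p = +-mono-≤ (p x) (∑-mono xs p)

∑-const : (xs : List T) (c : ℕ) → ∑[ x ∈ xs ] c ≡ length xs * c
∑-const []       c = refl
∑-const (x ∷ xs) c = cong (c +_) (∑-const xs c)

∑-zero : (xs : List T) → (∀ x → f x ≡ 0) → ∑ xs f ≡ 0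
∑-zero xs h = trans (∑-cong xs h) (trans (∑-const xs 0) (*-zeroʳ (length xs)))

∑-+ : (xs : List T) (f g : T → ℕ) → ∑[ x ∈ xs ] (f x + g x) ≡ ∑ xs f + ∑ xs g
∑-+ []       f g = refl
∑-+ (x ∷ xs) f g = trans (cong (f x + g x +_) (∑-+ xs f g)) (interchange (f x) (g x) _ _)
  where
  interchange : ∀ a b c d → a + b + (c + d) ≡ a + c + (b + d)
  interchange = solve-∀

∑-*ˡ : (xs : List T) (c : ℕ) (f : T → ℕ) → ∑[ x ∈ xs ] (c * f x) ≡ c * ∑ xs f
∑-*ˡ []       c f = sym (*-zeroʳ c)
∑-*ˡ (x ∷ xs) c f = trans (cong (c * f x +_) (∑-*ˡ xs c f)) (sym (*-distribˡ-+ c (f x) _))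

∑-*ʳ : (xs : List T) (c : ℕ) (f : T → ℕ) → ∑[ x ∈ xs ] (f x * c) ≡ ∑ xs f * c
∑-*ʳ xs c f = trans (∑-cong xs λ x → *-comm (f x) c) (trans (∑-*ˡ xs c f) (*-comm c _))

∑-swap : (xs : List S) (ys : List T) (f : S → T → ℕ) →
         ∑[ x ∈ xs ] ∑[ y ∈ ys ] f x y ≡ ∑[ y ∈ ys ] ∑[ x ∈ xs ] f x y
∑-swap []       ys f = sym (trans (∑-const ys 0) (*-zeroʳ (length ys)))
∑-swap (x ∷ xs) ys f =
  trans (cong (∑ ys (f x) +_) (∑-swap xs ys f)) (sym (∑-+ ys (f x) _))

∑-++ : (xs ys : List T) (f : T → ℕ) → ∑ (xs ++ ys) f ≡ ∑ xs f + ∑ ys f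
∑-++ xs ys f = trans (cong sum (map-++ f xs ys)) (sum-++ (map f xs) _)

∑-cartesianProductWith : (h : S → T → U) (xs : List S) (ys : List T) (f : U → ℕ) →
  ∑ (cartesianProductWith h xs ys) f ≡ ∑[ x ∈ xs ] ∑[ y ∈ ys ] f (h x y)
∑-cartesianProductWith h []       ys f = refl
∑-cartesianProductWith h (x ∷ xs) ys f =
  trans (∑-++ (map (h x) ys) _ f)
        (cong₂ _+_ (cong sum (sym (map-∘ ys))) (∑-cartesianProductWith h xs ys f))

∑-* : (xs : List S) (ys : List T) (f : S → ℕ) (g : T → ℕ) →
      ∑ xs f * ∑ ys g ≡ ∑[ x ∈ xs ] ∑[ y ∈ ys ] (f x * g y)
∑-* xs ys f g = trans (sym (∑-*ʳ xs _ f)) (∑-cong xs λ x → sym (∑-*ˡ ys (f x) g))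

-- The cross term stands on the left, so that the square of a difference can be summed over all
-- coefficients without leaving ℕ.
∣-∣-square : ∀ x y → ∣ x - y ∣ * ∣ x - y ∣ + 2 * (x * y) ≡ x * x + y * y
∣-∣-square x y with ≤-total x y
... | inj₁ x≤y with m≤n⇒∃[o]m+o≡n x≤y
... | d , refl = trans (cong (λ t → t * t + 2 * (x * (x + d))) (∣m-m+n∣≡n x d)) (expand x d)
  where
  expand : ∀ x d → d * d + 2 * (x * (x + d)) ≡ x * x + (x + d) * (x + d)
  expand = solve-∀
∣-∣-square x y | inj₂ y≤x with m≤n⇒∃[o]m+o≡n y≤x
... | d , refl = trans
  (cong (λ t → t * t + 2 * ((y + d) * y)) (trans (∣-∣-comm (y + d) y) (∣m-m+n∣≡n y d))) (expand y d)
  where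
  expand : ∀ y d → d * d + 2 * ((y + d) * y) ≡ (y + d) * (y + d) + y * y
  expand = solve-∀

-- Indicators

-- Built from `does` alone, so it agrees definitionally with the test that `countTuples` applies to
-- `numSolutions`.
⟦_⟧ : Dec P → ℕ
⟦ p ⟧ = if does p then 1 else 0

⟦⟧-true : (p : Dec P) → P → ⟦ p ⟧ ≡ 1
⟦⟧-true (yes _) _ = refl
⟦⟧-true (no ¬p) p = ⊥-elim (¬p p)

⟦⟧-false : (p : Dec P) → ¬ P → ⟦ p ⟧ ≡ 0
⟦⟧-false (yes p) ¬p = ⊥-elim (¬p p)
⟦⟧-false (no _)  _  = refl

⟦⟧-mono : (p : Dec P) (r : Dec Q) → (P → Q) → ⟦ p ⟧ ≤ ⟦ r ⟧
⟦⟧-mono (no _)  r h = z≤n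
⟦⟧-mono (yes p) r h = ≤-reflexive (sym (⟦⟧-true r (h p)))

⟦⟧-cong : (p : Dec P) (r : Dec Q) → (P → Q) → (Q → P) → ⟦ p ⟧ ≡ ⟦ r ⟧
⟦⟧-cong p r h h′ = ≤-antisym (⟦⟧-mono p r h) (⟦⟧-mono r p h′)

⟦⟧≤1 : (p : Dec P) → ⟦ p ⟧ ≤ 1
⟦⟧≤1 (yes _) = ≤-refl
⟦⟧≤1 (no _)  = z≤n

⟦⟧*-≤ : (p : Dec P) {a b : ℕ} → (P → a ≤ b) → ⟦ p ⟧ * a ≤ b
⟦⟧*-≤ (yes p) {a} h = subst (_≤ _) (sym (*-identityˡ a)) (h p)
⟦⟧*-≤ (no _)      h = z≤n

⟦⟧*⟦⟧-≤ : (p : Dec P) (r : Dec Q) {b : ℕ} → (P → Q → 1 ≤ b) → ⟦ p ⟧ * ⟦ r ⟧ ≤ b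
⟦⟧*⟦⟧-≤ p r h = ⟦⟧*-≤ p λ x → ≤-trans (≤-reflexive (sym (*-identityʳ _))) (⟦⟧*-≤ r (h x))

∑-allFin-δ : ∀ {n} (c : Fin n) (h : Fin n → ℕ) → ∑[ x ∈ allFin n ] (⟦ x ≟ᶠ c ⟧ * h x) ≡ h c
∑-allFin-δ {n} c h = trans (cong sum (map-tabulate (λ x → x) (λ x → ⟦ x ≟ᶠ c ⟧ * h x))) (go c h)
  where
  zeros : ∀ n → sum (tabulate {n = n} (λ _ → 0)) ≡ 0
  zeros zero    = refl
  zeros (suc n) = zeros n
  go : ∀ {n} (c : Fin n) (h : Fin n → ℕ) → sum (tabulate (λ x → ⟦ x ≟ᶠ c ⟧ * h x)) ≡ h c
  go {suc n} zero    h = trans (cong (1 * h zero +_) (zeros n)) (trans (+-identityʳ _) (*-identityˡ _))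
  -- The head indicator computes to 0 and `does (suc x ≟ᶠ suc c)` reduces to `does (x ≟ᶠ c)`, so the
  -- two goals coincide.
  go {suc n} (suc c) h = go c (h ∘ suc)

-- Carrying the field on `Fin q` with propositional equality allows matching on `refl`, rewriting
-- under indicators and summing over `allFin q`.
record FieldOn (q : ℕ) : Set where
  infixl 6 _⊕_
  infixl 7 _⊗_
  infix 8 ⊝_
  field
    _⊕_ _⊗_           : Fin q → Fin q → Fin q
    ⊝_                : Fin q → Fin q
    𝟘 𝟙               : Fin q
    isCommutativeRing : IsCommutativeRing _≡_ _⊕_ _⊗_ ⊝_ 𝟘 𝟙
    𝟙≢𝟘               : 𝟙 ≢ 𝟘
    inverse           : ∀ x → x ≢ 𝟘 → ∃ λ y → x ⊗ y ≡ 𝟙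

module Counting {q : ℕ} (𝕂 : FieldOn q) where
  open FieldOn 𝕂

  K : Set
  K = Fin q

  𝔽 : List K
  𝔽 = allFin q

  commutativeRing : CommutativeRing 0ℓ 0ℓ
  commutativeRing = record { isCommutativeRing = isCommutativeRing }

  module R = CommutativeRing commutativeRing

  open SemiringSolver R.commutativeSemiring using (solve; _:+_; _:*_; _:=_; con)
  open GroupProperties R.+-group using () renaming (∙-cancelˡ to ⊕-cancelˡ)

  private instance
    q-nonZero : NonZero q
    q-nonZero = nonZeroIndex 𝟘

  -- Sums over the field

  ∑-δ : ∀ c h → ∑[ x ∈ 𝔽 ] (⟦ x ≟ᶠ c ⟧ * h x) ≡ h c
  ∑-δ = ∑-allFin-δ

  ∑-one : ∀ c → ∑[ x ∈ 𝔽 ] ⟦ x ≟ᶠ c ⟧ ≡ 1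
  ∑-one c = trans (∑-cong 𝔽 λ x → sym (*-identityʳ _)) (∑-δ c λ _ → 1)

  ∑𝔽-const : ∀ c → ∑[ x ∈ 𝔽 ] c ≡ q * c
  ∑𝔽-const c = trans (∑-const 𝔽 c) (cong (_* c) (length-tabulate {n = q} (λ x → x)))

  ∑-unique : {P : K → Set} (P? : ∀ x → Dec (P x)) →
             (∀ {x y} → P x → P y → x ≡ y) → ∑[ x ∈ 𝔽 ] ⟦ P? x ⟧ ≤ 1
  ∑-unique P? unique with any? P?
  ... | yes (c , pc) = ≤-trans (∑-mono 𝔽 λ x → ⟦⟧-mono (P? x) (x ≟ᶠ c) λ px → unique px pc)
                               (≤-reflexive (∑-one c))
  ... | no ∄         = ≤-trans (≤-reflexive (∑-zero 𝔽 λ x → ⟦⟧-false (P? x) λ px → ∄ (x , px))) z≤n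

  -- Expanding `h (φ x)` by a Kronecker delta and exchanging the two sums replaces any permutation
  -- of lists.
  ∑-bijection : (φ ψ : K → K) → (∀ x → ψ (φ x) ≡ x) → (∀ y → φ (ψ y) ≡ y) →
                ∀ h → ∑[ x ∈ 𝔽 ] h (φ x) ≡ ∑ 𝔽 h
  ∑-bijection φ ψ ψφ φψ h = begin
    ∑[ x ∈ 𝔽 ] h (φ x)                                 ≡⟨ ∑-cong 𝔽 (λ x → sym (∑-δ (φ x) h)) ⟩
    ∑[ x ∈ 𝔽 ] ∑[ y ∈ 𝔽 ] (⟦ y ≟ᶠ φ x ⟧ * h y)         ≡⟨ ∑-swap 𝔽 𝔽 _ ⟩
    ∑[ y ∈ 𝔽 ] ∑[ x ∈ 𝔽 ] (⟦ y ≟ᶠ φ x ⟧ * h y)         ≡⟨ ∑-cong 𝔽 (λ y → ∑-*ʳ 𝔽 (h y) _) ⟩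
    ∑[ y ∈ 𝔽 ] ((∑[ x ∈ 𝔽 ] ⟦ y ≟ᶠ φ x ⟧) * h y)       ≡⟨ ∑-cong 𝔽 (λ y → cong (_* h y) (preimage y)) ⟩
    ∑[ y ∈ 𝔽 ] (1 * h y)                               ≡⟨ ∑-cong 𝔽 (λ y → *-identityˡ (h y)) ⟩
    ∑ 𝔽 h                                              ∎
    where
    open ≡-Reasoning
    preimage : ∀ y → ∑[ x ∈ 𝔽 ] ⟦ y ≟ᶠ φ x ⟧ ≡ 1
    preimage y = trans
      (∑-cong 𝔽 λ x → ⟦⟧-cong (y ≟ᶠ φ x) (x ≟ᶠ ψ y)
        (λ e → sym (trans (cong ψ e) (ψφ x))) (λ e → sym (trans (cong φ e) (φψ y))))
      (∑-one (ψ y))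

  -- Field arithmetic

  ⊗-cancelˡ : ∀ {s x y} → s ≢ 𝟘 → s ⊗ x ≡ s ⊗ y → x ≡ y
  ⊗-cancelˡ {s} {x} {y} s≢𝟘 e with inverse s s≢𝟘
  ... | i , si≡𝟙 = begin
    x             ≡⟨ sym (R.*-identityˡ x) ⟩
    𝟙 ⊗ x         ≡⟨ cong (_⊗ x) (sym si≡𝟙) ⟩
    s ⊗ i ⊗ x     ≡⟨ swap-middle s i x ⟩
    i ⊗ (s ⊗ x)   ≡⟨ cong (i ⊗_) e ⟩
    i ⊗ (s ⊗ y)   ≡⟨ sym (swap-middle s i y) ⟩
    s ⊗ i ⊗ y     ≡⟨ cong (_⊗ y) si≡𝟙 ⟩
    𝟙 ⊗ y         ≡⟨ R.*-identityˡ y ⟩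
    y             ∎
    where
    open ≡-Reasoning
    swap-middle : ∀ s i x → s ⊗ i ⊗ x ≡ i ⊗ (s ⊗ x)
    swap-middle = solve 3 (λ s i x → (s :* i :* x) := (i :* (s :* x))) refl

  ⊗-≢𝟘 : ∀ {x y} → x ≢ 𝟘 → y ≢ 𝟘 → x ⊗ y ≢ 𝟘
  ⊗-≢𝟘 {x} x≢𝟘 y≢𝟘 e = y≢𝟘 (⊗-cancelˡ x≢𝟘 (trans e (sym (R.zeroʳ x))))

  -- Handing out the difference as a witness lets callers match the equation with `refl`; what
  -- remains is free of negation and within reach of the semiring solver.
  difference : ∀ x y → ∃ λ d → x ≡ y ⊕ d
  difference x y = (⊝ y) ⊕ x , sym (trans (sym (R.+-assoc y (⊝ y) x))
    (trans (cong (_⊕ x) (R.-‿inverseʳ y)) (R.+-identityˡ x)))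

  infixr 9 _↑_
  _↑_ : K → ℕ → K
  x ↑ zero  = 𝟙
  x ↑ suc n = x ⊗ x ↑ n

  ↑-⊗ : ∀ x y n → (x ⊗ y) ↑ n ≡ x ↑ n ⊗ y ↑ n
  ↑-⊗ x y zero    = sym (R.*-identityˡ 𝟙)
  ↑-⊗ x y (suc n) = trans (cong (x ⊗ y ⊗_) (↑-⊗ x y n))
    (solve 4 (λ x y a b → (x :* y :* (a :* b)) := (x :* a :* (y :* b))) refl x y (x ↑ n) (y ↑ n))

  ↑-≢𝟘 : ∀ {x} n → x ≢ 𝟘 → x ↑ n ≢ 𝟘
  ↑-≢𝟘 zero    x≢𝟘 = 𝟙≢𝟘
  ↑-≢𝟘 (suc n) x≢𝟘 = ⊗-≢𝟘 x≢𝟘 (↑-≢𝟘 n x≢𝟘)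

  𝟘↑ : ∀ n .{{_ : NonZero n}} → 𝟘 ↑ n ≡ 𝟘
  𝟘↑ (suc n) = R.zeroˡ _

  ↑≡𝟘⇒≡𝟘 : ∀ {x} n → x ↑ n ≡ 𝟘 → x ≡ 𝟘
  ↑≡𝟘⇒≡𝟘 {x} n e with x ≟ᶠ 𝟘
  ... | yes x≡𝟘 = x≡𝟘
  ... | no x≢𝟘  = ⊥-elim (↑-≢𝟘 n x≢𝟘 e)

  ∑-shift : ∀ c h → ∑[ x ∈ 𝔽 ] h (c ⊕ x) ≡ ∑ 𝔽 h
  ∑-shift c = ∑-bijection (c ⊕_) ((⊝ c) ⊕_) (λ x → undo (⊝ c) c x (R.-‿inverseˡ c))
                                              (λ x → undo c (⊝ c) x (R.-‿inverseʳ c))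
    where
    undo : ∀ c d x → c ⊕ d ≡ 𝟘 → c ⊕ (d ⊕ x) ≡ x
    undo c d x e = trans (sym (R.+-assoc c d x)) (trans (cong (_⊕ x) e) (R.+-identityˡ x))

  ∑-scale : ∀ {s} → s ≢ 𝟘 → ∀ h → ∑[ x ∈ 𝔽 ] h (s ⊗ x) ≡ ∑ 𝔽 h
  ∑-scale {s} s≢𝟘 with inverse s s≢𝟘
  ... | i , si≡𝟙 = ∑-bijection (s ⊗_) (i ⊗_) (λ x → undo i s x (trans (R.*-comm i s) si≡𝟙))
                                              (λ x → undo s i x si≡𝟙)
    where
    undo : ∀ c d x → c ⊗ d ≡ 𝟙 → c ⊗ (d ⊗ x) ≡ x
    undo c d x e = trans (sym (R.*-assoc c d x)) (trans (cong (_⊗ x) e) (R.*-identityˡ x))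

  ∑-affine : ∀ {s} → s ≢ 𝟘 → ∀ c h → ∑[ x ∈ 𝔽 ] h (x ⊗ s ⊕ c) ≡ ∑ 𝔽 h
  ∑-affine {s} s≢𝟘 c h = begin
    ∑[ x ∈ 𝔽 ] h (x ⊗ s ⊕ c) ≡⟨ ∑-cong 𝔽 (λ x → cong h (commute x)) ⟩
    ∑[ x ∈ 𝔽 ] h (c ⊕ s ⊗ x) ≡⟨ ∑-scale s≢𝟘 (λ x → h (c ⊕ x)) ⟩
    ∑[ x ∈ 𝔽 ] h (c ⊕ x)     ≡⟨ ∑-shift c h ⟩
    ∑ 𝔽 h                    ∎
    where
    open ≡-Reasoning
    commute : ∀ x → x ⊗ s ⊕ c ≡ c ⊕ s ⊗ x
    commute x = solve 3 (λ x s c → (x :* s :+ c) := (c :+ s :* x)) refl x s c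

  -- Roots of monic polynomials

  -- Horner form, constant term first, with an implicit leading coefficient 1: the length of the
  -- vector is the degree, and the zero polynomial cannot occur.
  monic : ∀ {d} → Vec K d → K → K
  monic []      x = 𝟙
  monic (c ∷ p) x = c ⊕ x ⊗ monic p x

  -- Synthetic division by X - r, with X written as `r ⊕ t`. The constant term of the quotient is
  -- the value at `r` of the polynomial without its constant term.
  monic-divide : ∀ {d} (p : Vec K (suc d)) r → Σ (Vec K d) λ p′ →
    ∀ t → monic p (r ⊕ t) ≡ monic p r ⊕ t ⊗ monic p′ (r ⊕ t)
  monic-divide (c ∷ []) r = [] , λ t →
    solve 3 (λ c r t → (c :+ (r :+ t) :* con 1) := (c :+ r :* con 1 :+ t :* con 1)) refl c r t
  monic-divide (c ∷ p@(_ ∷ _)) r with monic-divide p r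
  ... | p′ , e = monic p r ∷ p′ , λ t → trans (cong (λ z → c ⊕ (r ⊕ t) ⊗ z) (e t))
    (solve 5 (λ c r t P Q → (c :+ (r :+ t) :* (P :+ t :* Q)) := (c :+ r :* P :+ t :* (P :+ (r :+ t) :* Q)))
      refl c r t (monic p r) (monic p′ (r ⊕ t)))

  monic-roots : ∀ {d} (p : Vec K d) → ∑[ x ∈ 𝔽 ] ⟦ monic p x ≟ᶠ 𝟘 ⟧ ≤ d
  monic-roots []        = ≤-reflexive (∑-zero 𝔽 λ x → ⟦⟧-false (𝟙 ≟ᶠ 𝟘) 𝟙≢𝟘)
  monic-roots {suc d} p with any? (λ x → monic p x ≟ᶠ 𝟘)
  ... | no ∄ = ≤-trans (≤-reflexive (∑-zero 𝔽 λ x → ⟦⟧-false (monic p x ≟ᶠ 𝟘) λ e → ∄ (x , e))) z≤n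
  ... | yes (r , pr≡𝟘) with monic-divide p r
  ... | p′ , divides = begin
    ∑[ x ∈ 𝔽 ] ⟦ monic p x ≟ᶠ 𝟘 ⟧                             ≤⟨ ∑-mono 𝔽 bound ⟩
    ∑[ x ∈ 𝔽 ] (⟦ x ≟ᶠ r ⟧ + ⟦ monic p′ x ≟ᶠ 𝟘 ⟧)             ≡⟨ ∑-+ 𝔽 _ _ ⟩
    ∑ 𝔽 (λ x → ⟦ x ≟ᶠ r ⟧) + ∑ 𝔽 (λ x → ⟦ monic p′ x ≟ᶠ 𝟘 ⟧)  ≤⟨ +-mono-≤ (≤-reflexive (∑-one r)) (monic-roots p′) ⟩
    suc d                                                     ∎
    where
    open ≤-Reasoning
    bound : ∀ x → ⟦ monic p x ≟ᶠ 𝟘 ⟧ ≤ ⟦ x ≟ᶠ r ⟧ + ⟦ monic p′ x ≟ᶠ 𝟘 ⟧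
    bound x with x ≟ᶠ r
    ... | yes _  = ≤-trans (⟦⟧≤1 (monic p x ≟ᶠ 𝟘)) (m≤m+n 1 _)
    ... | no x≢r with difference x r
    ... | t , refl = ⟦⟧-mono (monic p (r ⊕ t) ≟ᶠ 𝟘) (monic p′ (r ⊕ t) ≟ᶠ 𝟘) λ px≡𝟘 →
      ⊗-cancelˡ t≢𝟘 (trans (sym (trans (divides t) (trans (cong (_⊕ _) pr≡𝟘) (R.+-identityˡ _))))
        (trans px≡𝟘 (sym (R.zeroʳ t))))
      where
      t≢𝟘 : t ≢ 𝟘
      t≢𝟘 refl = x≢r (R.+-identityʳ r)

  ↑-roots : ∀ d .{{_ : NonZero d}} c → ∑[ x ∈ 𝔽 ] ⟦ x ↑ d ≟ᶠ c ⟧ ≤ d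
  ↑-roots (suc d) c = ≤-trans (∑-mono 𝔽 λ x → ⟦⟧-mono (x ↑ suc d ≟ᶠ c) (monic p x ≟ᶠ 𝟘) (root x))
                              (monic-roots p)
    where
    p : Vec K (suc d)
    p = (⊝ c) ∷ replicate d 𝟘
    monic-replicate : ∀ d x → monic (replicate d 𝟘) x ≡ x ↑ d
    monic-replicate zero    x = refl
    monic-replicate (suc d) x = trans (R.+-identityˡ _) (cong (x ⊗_) (monic-replicate d x))
    root : ∀ x → x ↑ suc d ≡ c → monic p x ≡ 𝟘
    root x e = trans (cong (λ z → (⊝ c) ⊕ x ⊗ z) (monic-replicate d x))
      (trans (cong ((⊝ c) ⊕_) e) (R.-‿inverseˡ c))

  -- Vectors and linear forms

  𝔽^ : ∀ n → List (Vec K n)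
  𝔽^ zero    = [] ∷ []
  𝔽^ (suc n) = cartesianProductWith _∷_ 𝔽 (𝔽^ n)

  ∑-∷ : ∀ {n} (f : Vec K (suc n) → ℕ) → ∑ (𝔽^ (suc n)) f ≡ ∑[ x ∈ 𝔽 ] ∑[ v ∈ 𝔽^ n ] f (x ∷ v)
  ∑-∷ {n} = ∑-cartesianProductWith _∷_ 𝔽 (𝔽^ n)

  ∑𝔽^-const : ∀ n c → ∑[ v ∈ 𝔽^ n ] c ≡ q ^ n * c
  ∑𝔽^-const zero    c = refl
  ∑𝔽^-const (suc n) c = begin
    ∑[ v ∈ 𝔽^ (suc n) ] c       ≡⟨ ∑-∷ {n} _ ⟩
    ∑[ x ∈ 𝔽 ] ∑[ v ∈ 𝔽^ n ] c  ≡⟨ ∑𝔽-const _ ⟩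
    q * ∑[ v ∈ 𝔽^ n ] c         ≡⟨ cong (q *_) (∑𝔽^-const n c) ⟩
    q * (q ^ n * c)             ≡⟨ sym (*-assoc q _ _) ⟩
    q ^ suc n * c               ∎
    where open ≡-Reasoning

  infix 4 _≟ᵛ_
  _≟ᵛ_ : ∀ {n} (v w : Vec K n) → Dec (v ≡ w)
  _≟ᵛ_ = ≡-dec _≟ᶠ_

  ⟦∷⟧ : ∀ {n} x y (v w : Vec K n) → ⟦ x ∷ v ≟ᵛ y ∷ w ⟧ ≡ ⟦ x ≟ᶠ y ⟧ * ⟦ v ≟ᵛ w ⟧
  ⟦∷⟧ x y v w with x ≟ᶠ y | v ≟ᵛ w
  ... | yes _ | yes _ = refl
  ... | yes _ | no _  = refl
  ... | no _  | yes _ = refl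
  ... | no _  | no _  = refl

  ∑-δᵛ : ∀ {n} (c : Vec K n) (h : Vec K n → ℕ) → ∑[ v ∈ 𝔽^ n ] (⟦ v ≟ᵛ c ⟧ * h v) ≡ h c
  ∑-δᵛ []       h = trans (+-identityʳ _) (*-identityˡ _)
  ∑-δᵛ {suc n} (c ∷ cs) h = begin
    ∑[ v ∈ 𝔽^ (suc n) ] (⟦ v ≟ᵛ c ∷ cs ⟧ * h v)
      ≡⟨ ∑-∷ {n} _ ⟩
    ∑[ x ∈ 𝔽 ] ∑[ v ∈ 𝔽^ n ] (⟦ x ∷ v ≟ᵛ c ∷ cs ⟧ * h (x ∷ v))
      ≡⟨ ∑-cong 𝔽 (λ x → ∑-cong (𝔽^ n) λ v →
           trans (cong (_* h (x ∷ v)) (⟦∷⟧ x c v cs)) (*-assoc ⟦ x ≟ᶠ c ⟧ _ _)) ⟩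
    ∑[ x ∈ 𝔽 ] ∑[ v ∈ 𝔽^ n ] (⟦ x ≟ᶠ c ⟧ * (⟦ v ≟ᵛ cs ⟧ * h (x ∷ v)))
      ≡⟨ ∑-cong 𝔽 (λ x → trans (∑-*ˡ (𝔽^ n) ⟦ x ≟ᶠ c ⟧ _) (cong (⟦ x ≟ᶠ c ⟧ *_) (∑-δᵛ cs _))) ⟩
    ∑[ x ∈ 𝔽 ] (⟦ x ≟ᶠ c ⟧ * h (x ∷ cs))
      ≡⟨ ∑-δ c _ ⟩
    h (c ∷ cs) ∎
    where open ≡-Reasoning

  𝟎 : ∀ {n} → Vec K n
  𝟎 {n} = replicate n 𝟘

  infixl 7 _∙_
  infixl 6 _⊞_

  _∙_ : ∀ {n} → K → Vec K n → Vec K n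
  c ∙ X = mapᵛ (c ⊗_) X

  _⊞_ : ∀ {n} → Vec K n → Vec K n → Vec K n
  _⊞_ = zipWithᵛ _⊕_

  dot : ∀ {n} → Vec K n → Vec K n → K
  dot []      []      = 𝟘
  dot (a ∷ A) (x ∷ X) = a ⊗ x ⊕ dot A X

  ⊞-difference : ∀ {n} (Y X : Vec K n) → ∃ λ Z → Y ≡ X ⊞ Z
  ⊞-difference []      []      = [] , refl
  ⊞-difference (y ∷ Y) (x ∷ X) with difference y x | ⊞-difference Y X
  ... | d , e | D , E = d ∷ D , cong₂ _∷_ e E

  ⊞-𝟎 : ∀ {n} (X : Vec K n) → X ⊞ 𝟎 ≡ X
  ⊞-𝟎 []      = refl
  ⊞-𝟎 (x ∷ X) = cong₂ _∷_ (R.+-identityʳ x) (⊞-𝟎 X)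

  dot-∙ : ∀ {n} (A : Vec K n) c X → dot A (c ∙ X) ≡ c ⊗ dot A X
  dot-∙ []      c []      = sym (R.zeroʳ c)
  dot-∙ (a ∷ A) c (x ∷ X) = trans (cong (a ⊗ (c ⊗ x) ⊕_) (dot-∙ A c X))
    (solve 4 (λ a c x s → (a :* (c :* x) :+ c :* s) := (c :* (a :* x :+ s))) refl a c x (dot A X))

  dot-⊞ : ∀ {n} (A X Z : Vec K n) → dot A (X ⊞ Z) ≡ dot A X ⊕ dot A Z
  dot-⊞ []      []      []      = sym (R.+-identityˡ 𝟘)
  dot-⊞ (a ∷ A) (x ∷ X) (z ∷ Z) = trans (cong (a ⊗ (x ⊕ z) ⊕_) (dot-⊞ A X Z))
    (solve 5 (λ a x z s t → (a :* (x :+ z) :+ (s :+ t)) := (a :* x :+ s :+ (a :* z :+ t)))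
      refl a x z (dot A X) (dot A Z))

  dot-𝟎 : ∀ {n} (A : Vec K n) → dot A 𝟎 ≡ 𝟘
  dot-𝟎 []      = refl
  dot-𝟎 (a ∷ A) = trans (cong₂ _⊕_ (R.zeroʳ a) (dot-𝟎 A)) (R.+-identityˡ 𝟘)

  Nonzero : ∀ {n} → Vec K n → Set
  Nonzero = Any (_≢ 𝟘)

  zero-or-nonzero : ∀ {n} (X : Vec K n) → X ≡ 𝟎 ⊎ Nonzero X
  zero-or-nonzero []      = inj₁ refl
  zero-or-nonzero (x ∷ X) with x ≟ᶠ 𝟘 | zero-or-nonzero X
  ... | no x≢𝟘   | _         = inj₂ (here x≢𝟘)
  ... | yes _    | inj₂ X≢𝟎  = inj₂ (there X≢𝟎)
  ... | yes refl | inj₁ refl = inj₁ refl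

  -- The coefficient facing a nonzero entry permutes the field by an affine map once the others are
  -- fixed. The extra `q` on the left avoids writing qⁿ⁻¹.
  dot-uniform : ∀ {n} {X : Vec K n} → Nonzero X → ∀ h →
                q * ∑[ A ∈ 𝔽^ n ] h (dot A X) ≡ q ^ n * ∑ 𝔽 h
  dot-uniform {suc n} {x ∷ X} (here x≢𝟘) h = begin
    q * ∑[ A ∈ 𝔽^ (suc n) ] h (dot A (x ∷ X))
      ≡⟨ cong (q *_) (trans (∑-∷ {n} _) (∑-swap 𝔽 (𝔽^ n) _)) ⟩
    q * ∑[ A ∈ 𝔽^ n ] ∑[ a ∈ 𝔽 ] h (a ⊗ x ⊕ dot A X)
      ≡⟨ cong (q *_) (trans (∑-cong (𝔽^ n) λ A → ∑-affine x≢𝟘 (dot A X) h) (∑𝔽^-const n _)) ⟩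
    q * (q ^ n * ∑ 𝔽 h)
      ≡⟨ sym (*-assoc q _ _) ⟩
    q ^ suc n * ∑ 𝔽 h ∎
    where open ≡-Reasoning
  dot-uniform {suc n} {x ∷ X} (there X≢𝟎) h = begin
    q * ∑[ A ∈ 𝔽^ (suc n) ] h (dot A (x ∷ X))
      ≡⟨ trans (cong (q *_) (∑-∷ {n} _)) (sym (∑-*ˡ 𝔽 q _)) ⟩
    ∑[ a ∈ 𝔽 ] (q * ∑[ A ∈ 𝔽^ n ] h (a ⊗ x ⊕ dot A X))
      ≡⟨ ∑-cong 𝔽 (λ a → trans (dot-uniform X≢𝟎 (λ u → h (a ⊗ x ⊕ u)))
           (cong (q ^ n *_) (∑-shift (a ⊗ x) h))) ⟩
    ∑[ a ∈ 𝔽 ] (q ^ n * ∑ 𝔽 h)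
      ≡⟨ trans (∑𝔽-const _) (sym (*-assoc q _ _)) ⟩
    q ^ suc n * ∑ 𝔽 h ∎
    where open ≡-Reasoning

  -- For nonzero `X` this is linear dependence; `c` may be zero, which covers `Y ≡ 𝟎`.
  Proportional : ∀ {n} → Vec K n → Vec K n → Set
  Proportional X Y = ∃ λ c → Y ≡ c ∙ X

  JointlyUniform : ∀ {n} → Vec K n → Vec K n → Set
  JointlyUniform {n} X Y = ∀ (h : K → K → ℕ) →
    q * (q * ∑[ A ∈ 𝔽^ n ] h (dot A X) (dot A Y)) ≡ q ^ n * ∑[ u ∈ 𝔽 ] ∑[ v ∈ 𝔽 ] h u v

  -- Row reduction at the first nonzero entry of `X`. Subtracting y/x times `X` leaves a remainder
  -- that starts with 0 and continues with `Z`. If `Z` is nonzero, the first coefficient makes the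
  -- form of `X` uniform while the others independently make the form of `Z` uniform.
  jointly-uniform : ∀ {n} {X : Vec K n} → Nonzero X → ∀ Y → Proportional X Y ⊎ JointlyUniform X Y
  jointly-uniform {suc n} {x ∷ X} (here x≢𝟘) (y ∷ Y) with inverse x x≢𝟘
  ... | i , xi≡𝟙 with ⊞-difference Y ((y ⊗ i) ∙ X)
  ... | Z , refl with zero-or-nonzero Z
  ... | inj₁ refl = inj₁ (y ⊗ i , cong₂ _∷_ (sym yix) (⊞-𝟎 _))
    where
    yix : y ⊗ i ⊗ x ≡ y
    yix = trans (R.*-assoc y i x) (trans (cong (y ⊗_) (trans (R.*-comm i x) xi≡𝟙)) (R.*-identityʳ y))
  ... | inj₂ Z≢𝟎 = inj₂ λ h → begin
    q * (q * ∑[ A ∈ 𝔽^ (suc n) ] h (dot A (x ∷ X)) (dot A (y ∷ Y′)))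
      ≡⟨ cong (λ s → q * (q * s)) (trans (∑-∷ {n} _) (∑-swap 𝔽 (𝔽^ n) _)) ⟩
    q * (q * ∑[ A ∈ 𝔽^ n ] ∑[ a ∈ 𝔽 ] h (a ⊗ x ⊕ dot A X) (a ⊗ y ⊕ dot A Y′))
      ≡⟨ cong (λ s → q * (q * s)) (∑-cong (𝔽^ n) λ A → trans
           (∑-cong 𝔽 λ a → cong (h (a ⊗ x ⊕ dot A X)) (second a A))
           (∑-affine x≢𝟘 (dot A X) λ u → h u (c ⊗ u ⊕ dot A Z))) ⟩
    q * (q * ∑[ A ∈ 𝔽^ n ] ∑[ u ∈ 𝔽 ] h u (c ⊗ u ⊕ dot A Z))
      ≡⟨ cong (q *_) (trans (cong (q *_) (∑-swap (𝔽^ n) 𝔽 _)) (sym (∑-*ˡ 𝔽 q _))) ⟩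
    q * (∑[ u ∈ 𝔽 ] (q * ∑[ A ∈ 𝔽^ n ] h u (c ⊗ u ⊕ dot A Z)))
      ≡⟨ cong (q *_) (∑-cong 𝔽 λ u → trans (dot-uniform Z≢𝟎 λ w → h u (c ⊗ u ⊕ w))
           (cong (q ^ n *_) (∑-shift (c ⊗ u) (h u)))) ⟩
    q * (∑[ u ∈ 𝔽 ] (q ^ n * ∑[ v ∈ 𝔽 ] h u v))
      ≡⟨ trans (cong (q *_) (∑-*ˡ 𝔽 (q ^ n) _)) (sym (*-assoc q _ _)) ⟩
    q ^ suc n * ∑[ u ∈ 𝔽 ] ∑[ v ∈ 𝔽 ] h u v ∎
    where
    open ≡-Reasoning
    c  = y ⊗ i
    Y′ = c ∙ X ⊞ Z
    second : ∀ a A → a ⊗ y ⊕ dot A Y′ ≡ c ⊗ (a ⊗ x ⊕ dot A X) ⊕ dot A Z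
    second a A = begin
      a ⊗ y ⊕ dot A Y′
        ≡⟨ cong₂ _⊕_ (trans (sym (R.*-identityʳ _)) (cong (a ⊗ y ⊗_) (sym xi≡𝟙)))
             (trans (dot-⊞ A (c ∙ X) Z) (cong (_⊕ dot A Z) (dot-∙ A c X))) ⟩
      a ⊗ y ⊗ (x ⊗ i) ⊕ (c ⊗ dot A X ⊕ dot A Z)
        ≡⟨ solve 6 (λ a y x i s t → (a :* y :* (x :* i) :+ (y :* i :* s :+ t)) := (y :* i :* (a :* x :+ s) :+ t))
             refl a y x i (dot A X) (dot A Z) ⟩
      c ⊗ (a ⊗ x ⊕ dot A X) ⊕ dot A Z ∎
  jointly-uniform {suc n} {x ∷ X} (there X≢𝟎) (y ∷ Y) with jointly-uniform X≢𝟎 Y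
  ... | inj₂ uniform = inj₂ λ h → begin
    q * (q * ∑[ A ∈ 𝔽^ (suc n) ] h (dot A (x ∷ X)) (dot A (y ∷ Y)))
      ≡⟨ cong (λ s → q * (q * s)) (∑-∷ {n} _) ⟩
    q * (q * ∑[ a ∈ 𝔽 ] ∑[ A ∈ 𝔽^ n ] h (a ⊗ x ⊕ dot A X) (a ⊗ y ⊕ dot A Y))
      ≡⟨ trans (cong (q *_) (sym (∑-*ˡ 𝔽 q _))) (sym (∑-*ˡ 𝔽 q _)) ⟩
    ∑[ a ∈ 𝔽 ] (q * (q * ∑[ A ∈ 𝔽^ n ] h (a ⊗ x ⊕ dot A X) (a ⊗ y ⊕ dot A Y)))
      ≡⟨ ∑-cong 𝔽 (λ a → trans (uniform λ u v → h (a ⊗ x ⊕ u) (a ⊗ y ⊕ v))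
           (cong (q ^ n *_) (trans
             (∑-cong 𝔽 λ u → ∑-shift (a ⊗ y) (h (a ⊗ x ⊕ u)))
             (∑-shift (a ⊗ x) λ u → ∑ 𝔽 (h u))))) ⟩
    ∑[ a ∈ 𝔽 ] (q ^ n * ∑[ u ∈ 𝔽 ] ∑[ v ∈ 𝔽 ] h u v)
      ≡⟨ trans (∑𝔽-const _) (sym (*-assoc q _ _)) ⟩
    q ^ suc n * ∑[ u ∈ 𝔽 ] ∑[ v ∈ 𝔽 ] h u v ∎
    where open ≡-Reasoning
  -- The tails are proportional, so only the defect `d` of the heads can separate the forms: the
  -- second one is c times the first plus `a ⊗ d`, and for nonzero `d` the head coefficient makes
  -- that term uniform.
  ... | inj₁ (c , refl) with difference y (c ⊗ x)
  ... | d , refl with d ≟ᶠ 𝟘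
  ... | yes refl = inj₁ (c , cong (_∷ _) (R.+-identityʳ _))
  ... | no d≢𝟘 = inj₂ λ h → begin
    q * (q * ∑[ A ∈ 𝔽^ (suc n) ] h (dot A (x ∷ X)) (dot A (y′ ∷ c ∙ X)))
      ≡⟨ cong (λ s → q * (q * s)) (trans (∑-∷ {n} _) (∑-cong 𝔽 λ a → ∑-cong (𝔽^ n) λ A →
           cong (h (a ⊗ x ⊕ dot A X)) (second a A))) ⟩
    q * (q * ∑[ a ∈ 𝔽 ] ∑[ A ∈ 𝔽^ n ] h (a ⊗ x ⊕ dot A X) (a ⊗ d ⊕ c ⊗ (a ⊗ x ⊕ dot A X)))
      ≡⟨ cong (q *_) (sym (∑-*ˡ 𝔽 q _)) ⟩
    q * ∑[ a ∈ 𝔽 ] (q * ∑[ A ∈ 𝔽^ n ] h (a ⊗ x ⊕ dot A X) (a ⊗ d ⊕ c ⊗ (a ⊗ x ⊕ dot A X)))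
      ≡⟨ cong (q *_) (∑-cong 𝔽 λ a → trans
           (dot-uniform X≢𝟎 λ u → h (a ⊗ x ⊕ u) (a ⊗ d ⊕ c ⊗ (a ⊗ x ⊕ u)))
           (cong (q ^ n *_) (∑-shift (a ⊗ x) λ u → h u (a ⊗ d ⊕ c ⊗ u)))) ⟩
    q * ∑[ a ∈ 𝔽 ] (q ^ n * ∑[ u ∈ 𝔽 ] h u (a ⊗ d ⊕ c ⊗ u))
      ≡⟨ cong (q *_) (trans (∑-*ˡ 𝔽 (q ^ n) _) (cong (q ^ n *_) (∑-swap 𝔽 𝔽 _))) ⟩
    q * (q ^ n * ∑[ u ∈ 𝔽 ] ∑[ a ∈ 𝔽 ] h u (a ⊗ d ⊕ c ⊗ u))
      ≡⟨ cong (λ s → q * (q ^ n * s)) (∑-cong 𝔽 λ u → ∑-affine d≢𝟘 (c ⊗ u) (h u)) ⟩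
    q * (q ^ n * ∑[ u ∈ 𝔽 ] ∑[ v ∈ 𝔽 ] h u v)
      ≡⟨ sym (*-assoc q _ _) ⟩
    q ^ suc n * ∑[ u ∈ 𝔽 ] ∑[ v ∈ 𝔽 ] h u v ∎
    where
    open ≡-Reasoning
    y′ = c ⊗ x ⊕ d
    second : ∀ a A → a ⊗ y′ ⊕ dot A (c ∙ X) ≡ a ⊗ d ⊕ c ⊗ (a ⊗ x ⊕ dot A X)
    second a A = trans (cong (a ⊗ y′ ⊕_) (dot-∙ A c X))
      (solve 5 (λ a c x d s → (a :* (c :* x :+ d) :+ c :* s) := (a :* d :+ c :* (a :* x :+ s)))
        refl a c x d (dot A X))

  ∑-≥ : ∀ (h : K → ℕ) c → h c ≤ ∑ 𝔽 h
  ∑-≥ h c = ≤-trans (≤-reflexive (sym (∑-δ c h))) (∑-mono 𝔽 λ x → ⟦⟧*-≤ (x ≟ᶠ c) λ _ → ≤-refl)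

  -- Products of coordinates

  prod : ∀ {n} → Vec K n → K
  prod []      = 𝟙
  prod (x ∷ v) = x ⊗ prod v

  prod-𝟎 : ∀ {n} → prod (𝟎 {suc n}) ≡ 𝟘
  prod-𝟎 = R.zeroˡ _

  -- Union bound over the coordinates, each of which vanishes on one q-th of the space.
  prod-zeros : ∀ n → q * ∑[ x ∈ 𝔽^ n ] ⟦ prod x ≟ᶠ 𝟘 ⟧ ≤ n * q ^ n
  prod-zeros zero    = ≤-reflexive (trans
    (cong (q *_) (trans (+-identityʳ _) (⟦⟧-false (𝟙 ≟ᶠ 𝟘) 𝟙≢𝟘))) (*-zeroʳ q))
  prod-zeros (suc n) = begin
    q * ∑[ x ∈ 𝔽^ (suc n) ] ⟦ prod x ≟ᶠ 𝟘 ⟧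
      ≡⟨ cong (q *_) (∑-∷ {n} _) ⟩
    q * ∑[ x ∈ 𝔽 ] ∑[ v ∈ 𝔽^ n ] ⟦ x ⊗ prod v ≟ᶠ 𝟘 ⟧
      ≤⟨ *-monoʳ-≤ q (∑-mono 𝔽 λ x → ∑-mono (𝔽^ n) λ v → zero-factor x (prod v)) ⟩
    q * ∑[ x ∈ 𝔽 ] ∑[ v ∈ 𝔽^ n ] (⟦ x ≟ᶠ 𝟘 ⟧ + ⟦ prod v ≟ᶠ 𝟘 ⟧)
      ≡⟨ cong (q *_) (trans (∑-cong 𝔽 λ x → ∑-+ (𝔽^ n) _ _) (∑-+ 𝔽 _ _)) ⟩
    q * (∑[ x ∈ 𝔽 ] ∑[ v ∈ 𝔽^ n ] ⟦ x ≟ᶠ 𝟘 ⟧ + ∑[ x ∈ 𝔽 ] ∑[ v ∈ 𝔽^ n ] ⟦ prod v ≟ᶠ 𝟘 ⟧)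
      ≡⟨ cong (q *_) (cong₂ _+_
           (trans (∑-cong 𝔽 λ x → ∑𝔽^-const n _) (trans (∑-*ˡ 𝔽 (q ^ n) _) (cong (q ^ n *_) (∑-one 𝟘))))
           (∑𝔽-const _)) ⟩
    q * (q ^ n * 1 + q * ∑[ v ∈ 𝔽^ n ] ⟦ prod v ≟ᶠ 𝟘 ⟧)
      ≤⟨ *-monoʳ-≤ q (+-monoʳ-≤ (q ^ n * 1) (prod-zeros n)) ⟩
    q * (q ^ n * 1 + n * q ^ n)
      ≡⟨ rearrange q (q ^ n) n ⟩
    suc n * q ^ suc n ∎
    where
    open ≤-Reasoning
    rearrange : ∀ q s n → q * (s * 1 + n * s) ≡ suc n * (q * s)
    rearrange = solve-∀
    zero-factor : ∀ x p → ⟦ x ⊗ p ≟ᶠ 𝟘 ⟧ ≤ ⟦ x ≟ᶠ 𝟘 ⟧ + ⟦ p ≟ᶠ 𝟘 ⟧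
    zero-factor x p with x ≟ᶠ 𝟘 | p ≟ᶠ 𝟘
    ... | yes _  | _      = ≤-trans (⟦⟧≤1 (x ⊗ p ≟ᶠ 𝟘)) (m≤m+n 1 _)
    ... | no _   | yes _  = ⟦⟧≤1 (x ⊗ p ≟ᶠ 𝟘)
    ... | no x≢𝟘 | no p≢𝟘 = ≤-reflexive (⟦⟧-false (x ⊗ p ≟ᶠ 𝟘) (⊗-≢𝟘 x≢𝟘 p≢𝟘))

  -- The equation and its root counts

  module Equation (k m : ℕ) .{{_ : NonZero k}} .{{_ : NonZero m}} (a : K) (a≢𝟘 : a ≢ 𝟘) where

    ρ : K → ℕ
    ρ c = ∑[ u ∈ 𝔽 ] ⟦ u ↑ k ≟ᶠ c ⟧

    ρ-𝟘 : ρ 𝟘 ≡ 1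
    ρ-𝟘 = trans (∑-cong 𝔽 λ u → ⟦⟧-cong (u ↑ k ≟ᶠ 𝟘) (u ≟ᶠ 𝟘) (↑≡𝟘⇒≡𝟘 k) λ { refl → 𝟘↑ k }) (∑-one 𝟘)

    -- If `c` is 0, every summand is `ρ 𝟘`, which is 1; otherwise each `u` is counted once, at the
    -- `x` with x c = uᵏ. That the total does not depend on `c` keeps the main term exact even where
    -- the product of the coordinates vanishes.
    ∑-ρ : ∀ c → ∑[ x ∈ 𝔽 ] ρ (x ⊗ c) ≡ q
    ∑-ρ c with c ≟ᶠ 𝟘
    ... | yes refl = trans (∑-cong 𝔽 λ x → trans (cong ρ (R.zeroʳ x)) ρ-𝟘)
                           (trans (∑𝔽-const 1) (*-identityʳ q))
    ... | no c≢𝟘   = begin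
      ∑[ x ∈ 𝔽 ] ρ (x ⊗ c)                      ≡⟨ ∑-cong 𝔽 (λ x → cong ρ (R.*-comm x c)) ⟩
      ∑[ x ∈ 𝔽 ] ρ (c ⊗ x)                      ≡⟨ ∑-scale c≢𝟘 ρ ⟩
      ∑[ x ∈ 𝔽 ] ∑[ u ∈ 𝔽 ] ⟦ u ↑ k ≟ᶠ x ⟧      ≡⟨ ∑-swap 𝔽 𝔽 _ ⟩
      ∑[ u ∈ 𝔽 ] ∑[ x ∈ 𝔽 ] ⟦ u ↑ k ≟ᶠ x ⟧      ≡⟨ ∑-cong 𝔽 (λ u → trans
                                                      (∑-cong 𝔽 λ x → ⟦⟧-cong (u ↑ k ≟ᶠ x) (x ≟ᶠ u ↑ k) sym sym)
                                                      (∑-one (u ↑ k))) ⟩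
      ∑[ u ∈ 𝔽 ] 1                              ≡⟨ trans (∑𝔽-const 1) (*-identityʳ q) ⟩
      q                                         ∎
      where open ≡-Reasoning

    ∑-ρ-prod : ∀ n B → ∑[ x ∈ 𝔽^ (suc n) ] ρ (B ⊗ prod x) ≡ q ^ suc n
    ∑-ρ-prod n B = begin
      ∑[ x ∈ 𝔽^ (suc n) ] ρ (B ⊗ prod x)
        ≡⟨ trans (∑-∷ {n} _) (∑-swap 𝔽 (𝔽^ n) _) ⟩
      ∑[ v ∈ 𝔽^ n ] ∑[ x ∈ 𝔽 ] ρ (B ⊗ (x ⊗ prod v))
        ≡⟨ ∑-cong (𝔽^ n) (λ v → trans (∑-cong 𝔽 λ x → cong ρ (exchange B x (prod v))) (∑-ρ (B ⊗ prod v))) ⟩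
      ∑[ v ∈ 𝔽^ n ] q
        ≡⟨ trans (∑𝔽^-const n q) (*-comm (q ^ n) q) ⟩
      q ^ suc n ∎
      where
      open ≡-Reasoning
      exchange : ∀ b x p → b ⊗ (x ⊗ p) ≡ x ⊗ (b ⊗ p)
      exchange = solve 3 (λ b x p → (b :* (x :* p)) := (x :* (b :* p))) refl

    -- The equation sees a vector only through the value `u` of its linear form and the product `α`
    -- of its coordinates.
    hit : K → K → K → ℕ
    hit α B u = ⟦ (u ⊕ a) ↑ k ≟ᶠ B ⊗ α ⟧

    ∑-hit : ∀ α B → ∑[ u ∈ 𝔽 ] hit α B u ≡ ρ (B ⊗ α)
    ∑-hit α B = trans (∑-cong 𝔽 λ u → cong (λ s → ⟦ s ↑ k ≟ᶠ B ⊗ α ⟧) (R.+-comm u a))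
                      (∑-shift a λ u → ⟦ u ↑ k ≟ᶠ B ⊗ α ⟧)

    ∑∑-hit : ∀ α → ∑[ u ∈ 𝔽 ] ∑[ B ∈ 𝔽 ] hit α B u ≡ q
    ∑∑-hit α = trans (∑-swap 𝔽 𝔽 _) (trans (∑-cong 𝔽 λ B → ∑-hit α B) (∑-ρ α))

    powers : ∀ {n} → Vec K n → Vec K n
    powers = mapᵛ (_↑ m)

    powers-𝟎 : ∀ {n} → powers (𝟎 {n}) ≡ 𝟎
    powers-𝟎 {zero}  = refl
    powers-𝟎 {suc n} = cong₂ _∷_ (𝟘↑ m) powers-𝟎

    powers-nonzero : ∀ {n} {x : Vec K n} → Nonzero x → Nonzero (powers x)
    powers-nonzero (here x≢𝟘)  = here (↑-≢𝟘 m x≢𝟘)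
    powers-nonzero (there x≢𝟎) = there (powers-nonzero x≢𝟎)

    -- First moment

    χ : ∀ {n} → Vec K n → K → Vec K n → ℕ
    χ A B x = hit (prod x) B (dot A (powers x))

    N : ∀ {n} → Vec K n → K → ℕ
    N {n} A B = ∑[ x ∈ 𝔽^ n ] χ A B x

    -- At the origin the equation reads aᵏ = 0. This disposes of the one vector whose linear form is
    -- not equidistributed.
    χ-𝟎 : ∀ {n} (A : Vec K (suc n)) B → χ A B 𝟎 ≡ 0
    χ-𝟎 {n} A B = ⟦⟧-false ((dot A (powers 𝟎) ⊕ a) ↑ k ≟ᶠ B ⊗ prod (𝟎 {suc n})) λ e →
      ↑-≢𝟘 k a≢𝟘 (trans (cong (_↑ k) (sym value)) (trans e (trans (cong (B ⊗_) (prod-𝟎 {n})) (R.zeroʳ B))))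
      where
      value : dot A (powers 𝟎) ⊕ a ≡ a
      value = trans (cong (_⊕ a) (trans (cong (dot A) powers-𝟎) (dot-𝟎 A))) (R.+-identityˡ a)

    first-moment : ∀ {n} {x : Vec K n} → Nonzero x → ∑[ A ∈ 𝔽^ n ] ∑[ B ∈ 𝔽 ] χ A B x ≡ q ^ n
    first-moment {n} {x} x≢𝟎 = *-cancelˡ-≡ _ _ q (trans
      (dot-uniform (powers-nonzero x≢𝟎) λ u → ∑[ B ∈ 𝔽 ] hit (prod x) B u)
      (trans (cong (q ^ n *_) (∑∑-hit (prod x))) (*-comm (q ^ n) q)))

    -- The mean enters the variance with a minus sign, so a lower bound is what is wanted. Each
    -- nonzero vector contributes qⁿ; the added `q ^ n` pays for `𝟎`.
    ∑N-lower : ∀ n → q ^ n * q ^ n ≤ ∑[ A ∈ 𝔽^ n ] ∑[ B ∈ 𝔽 ] N A B + q ^ n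
    ∑N-lower n = begin
      q ^ n * q ^ n
        ≡⟨ sym (∑𝔽^-const n (q ^ n)) ⟩
      ∑[ x ∈ 𝔽^ n ] (q ^ n)
        ≤⟨ ∑-mono (𝔽^ n) bound ⟩
      ∑[ x ∈ 𝔽^ n ] (∑[ A ∈ 𝔽^ n ] ∑[ B ∈ 𝔽 ] χ A B x + ⟦ x ≟ᵛ 𝟎 ⟧ * q ^ n)
        ≡⟨ ∑-+ (𝔽^ n) _ _ ⟩
      ∑[ x ∈ 𝔽^ n ] ∑[ A ∈ 𝔽^ n ] ∑[ B ∈ 𝔽 ] χ A B x + ∑[ x ∈ 𝔽^ n ] (⟦ x ≟ᵛ 𝟎 ⟧ * q ^ n)
        ≡⟨ cong₂ _+_ (trans (∑-swap (𝔽^ n) (𝔽^ n) _) (∑-cong (𝔽^ n) λ A → ∑-swap (𝔽^ n) 𝔽 _))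
             (∑-δᵛ {n} 𝟎 λ _ → q ^ n) ⟩
      ∑[ A ∈ 𝔽^ n ] ∑[ B ∈ 𝔽 ] N A B + q ^ n ∎
      where
      open ≤-Reasoning
      bound : ∀ x → q ^ n ≤ ∑[ A ∈ 𝔽^ n ] ∑[ B ∈ 𝔽 ] χ A B x + ⟦ x ≟ᵛ 𝟎 ⟧ * q ^ n
      bound x with zero-or-nonzero x
      ... | inj₂ x≢𝟎  = ≤-trans (≤-reflexive (sym (first-moment x≢𝟎))) (m≤m+n _ _)
      ... | inj₁ refl = ≤-trans (≤-reflexive (sym (trans (cong (_* q ^ n) (⟦⟧-true (𝟎 {n} ≟ᵛ 𝟎) refl)) (*-identityˡ _))))
                                (m≤n+m _ _)

    -- Pairs of solutions

    pairs : ∀ {n} → Vec K n → Vec K n → ℕ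
    pairs {n} x y = ∑[ A ∈ 𝔽^ n ] ∑[ B ∈ 𝔽 ] (χ A B x * χ A B y)

    pairs-𝟎 : ∀ {n} (y : Vec K (suc n)) → pairs 𝟎 y ≡ 0
    pairs-𝟎 {n} y = ∑-zero (𝔽^ (suc n)) λ A → ∑-zero 𝔽 λ B → cong (_* χ A B y) (χ-𝟎 A B)

    generic : K → K → ℕ
    generic α β = ∑[ B ∈ 𝔽 ] (ρ (B ⊗ α) * ρ (B ⊗ β))

    pairs-generic : ∀ {n} (x y : Vec K n) → JointlyUniform (powers x) (powers y) →
                    q * (q * pairs x y) ≡ q ^ n * generic (prod x) (prod y)
    pairs-generic {n} x y uniform = trans
      (uniform λ u v → ∑[ B ∈ 𝔽 ] (hit (prod x) B u * hit (prod y) B v))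
      (cong (q ^ n *_) (begin
        ∑[ u ∈ 𝔽 ] ∑[ v ∈ 𝔽 ] ∑[ B ∈ 𝔽 ] (hit (prod x) B u * hit (prod y) B v)
          ≡⟨ trans (∑-cong 𝔽 λ u → ∑-swap 𝔽 𝔽 _) (∑-swap 𝔽 𝔽 _) ⟩
        ∑[ B ∈ 𝔽 ] ∑[ u ∈ 𝔽 ] ∑[ v ∈ 𝔽 ] (hit (prod x) B u * hit (prod y) B v)
          ≡⟨ ∑-cong 𝔽 (λ B → trans (sym (∑-* 𝔽 𝔽 (hit (prod x) B) (hit (prod y) B)))
               (cong₂ _*_ (∑-hit (prod x) B) (∑-hit (prod y) B))) ⟩
        generic (prod x) (prod y) ∎))
      where open ≡-Reasoning

    -- Taken over all pairs, dependent ones included, the sum splits for each `B` into a product of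
    -- two sums that do not depend on `B`; hence an exact value.
    ∑-generic : ∀ n → ∑[ x ∈ 𝔽^ (suc n) ] ∑[ y ∈ 𝔽^ (suc n) ] generic (prod x) (prod y)
                      ≡ q * (q ^ suc n * q ^ suc n)
    ∑-generic n = begin
      ∑[ x ∈ V ] ∑[ y ∈ V ] generic (prod x) (prod y)
        ≡⟨ trans (∑-cong V λ x → ∑-swap V 𝔽 _) (∑-swap V 𝔽 _) ⟩
      ∑[ B ∈ 𝔽 ] ∑[ x ∈ V ] ∑[ y ∈ V ] (ρ (B ⊗ prod x) * ρ (B ⊗ prod y))
        ≡⟨ ∑-cong 𝔽 (λ B → trans (sym (∑-* V V _ _)) (cong₂ _*_ (∑-ρ-prod n B) (∑-ρ-prod n B))) ⟩
      ∑[ B ∈ 𝔽 ] (q ^ suc n * q ^ suc n)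
        ≡⟨ ∑𝔽-const _ ⟩
      q * (q ^ suc n * q ^ suc n) ∎
      where
      open ≡-Reasoning
      V = 𝔽^ (suc n)

    -- What remains of `pairs` when the second form is `c` times the first: a single uniform value
    -- `u` governs both equations.
    special : K → K → K → ℕ
    special c α β = ∑[ u ∈ 𝔽 ] ∑[ B ∈ 𝔽 ] (hit α B u * hit β B (c ⊗ u))

    pairs-special : ∀ {n} (x y : Vec K n) c → Nonzero x → powers y ≡ c ∙ powers x →
                    q * pairs x y ≡ q ^ n * special c (prod x) (prod y)
    pairs-special {n} x y c x≢𝟎 e = trans
      (cong (q *_) (∑-cong (𝔽^ n) λ A → ∑-cong 𝔽 λ B → cong (λ s → χ A B x * hit (prod y) B s)
        (trans (cong (dot A) e) (dot-∙ A c (powers x)))))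
      (dot-uniform (powers-nonzero x≢𝟎) λ u → ∑[ B ∈ 𝔽 ] (hit (prod x) B u * hit (prod y) B (c ⊗ u)))

    special≤q : ∀ c α β → special c α β ≤ q
    special≤q c α β = ≤-trans
      (∑-mono 𝔽 λ u → ∑-mono 𝔽 λ B → ≤-trans (*-monoʳ-≤ (hit α B u) (⟦⟧≤1 ((c ⊗ u ⊕ a) ↑ k ≟ᶠ B ⊗ β)))
                                           (≤-reflexive (*-identityʳ _)))
      (≤-reflexive (∑∑-hit α))

    -- With α ≢ 𝟘 and c ≢ 𝟙, a solution (u , B) is determined by the ratio
    -- w = (c u + a) / (u + a), which satisfies wᵏ α = β.
    special≤k : ∀ c α β → α ≢ 𝟘 → c ≢ 𝟙 → special c α β ≤ k
    special≤k c α β α≢𝟘 c≢𝟙 = begin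
      ∑[ u ∈ 𝔽 ] ∑[ B ∈ 𝔽 ] (hit α B u * hit β B (c ⊗ u))
        ≤⟨ ∑-mono 𝔽 (λ u → ∑-mono 𝔽 λ B →
             ⟦⟧*⟦⟧-≤ ((u ⊕ a) ↑ k ≟ᶠ B ⊗ α) ((c ⊗ u ⊕ a) ↑ k ≟ᶠ B ⊗ β) (ratio u B)) ⟩
      -- Each solution is charged to its ratio `w`. Summed from the inside, `t` allows one `B` for
      -- each `u`, `s` one `u` for each `w`, and `r` at most `k` ratios.
      ∑[ u ∈ 𝔽 ] ∑[ B ∈ 𝔽 ] ∑[ w ∈ 𝔽 ] (r w * (s w u * t u B))
        ≡⟨ trans (∑-cong 𝔽 λ u → ∑-swap 𝔽 𝔽 _) (∑-swap 𝔽 𝔽 _) ⟩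
      ∑[ w ∈ 𝔽 ] ∑[ u ∈ 𝔽 ] ∑[ B ∈ 𝔽 ] (r w * (s w u * t u B))
        ≡⟨ ∑-cong 𝔽 (λ w → trans
             (∑-cong 𝔽 λ u → trans (∑-*ˡ 𝔽 (r w) _) (cong (r w *_) (∑-*ˡ 𝔽 (s w u) (t u))))
             (∑-*ˡ 𝔽 (r w) _)) ⟩
      ∑[ w ∈ 𝔽 ] (r w * ∑[ u ∈ 𝔽 ] (s w u * ∑[ B ∈ 𝔽 ] t u B))
        ≤⟨ ∑-mono 𝔽 (λ w → *-monoʳ-≤ (r w) (∑-mono 𝔽 λ u → *-monoʳ-≤ (s w u)
             (∑-unique (λ B → B ⊗ α ≟ᶠ (u ⊕ a) ↑ k) unique-B))) ⟩
      ∑[ w ∈ 𝔽 ] (r w * ∑[ u ∈ 𝔽 ] (s w u * 1))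
        ≤⟨ ∑-mono 𝔽 (λ w → *-monoʳ-≤ (r w) (≤-trans
             (≤-reflexive (∑-cong 𝔽 λ u → *-identityʳ (s w u)))
             (∑-unique (λ u → c ⊗ u ⊕ a ≟ᶠ w ⊗ (u ⊕ a)) (unique-u w)))) ⟩
      ∑[ w ∈ 𝔽 ] (r w * 1)
        ≤⟨ ∑-mono 𝔽 (λ w → ≤-trans (≤-reflexive (*-identityʳ (r w)))
             (⟦⟧-mono (w ↑ k ⊗ α ≟ᶠ β) (w ↑ k ≟ᶠ β ⊗ α⁻¹) (divide w))) ⟩
      ∑[ w ∈ 𝔽 ] ⟦ w ↑ k ≟ᶠ β ⊗ α⁻¹ ⟧
        ≤⟨ ↑-roots k (β ⊗ α⁻¹) ⟩
      k ∎
      where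
      open ≤-Reasoning
      r : K → ℕ
      r w = ⟦ w ↑ k ⊗ α ≟ᶠ β ⟧
      s t : K → K → ℕ
      s w u = ⟦ c ⊗ u ⊕ a ≟ᶠ w ⊗ (u ⊕ a) ⟧
      t u B = ⟦ B ⊗ α ≟ᶠ (u ⊕ a) ↑ k ⟧
      α⁻¹ = proj₁ (inverse α α≢𝟘)

      divide : ∀ w → w ↑ k ⊗ α ≡ β → w ↑ k ≡ β ⊗ α⁻¹
      divide w refl = sym (trans (R.*-assoc (w ↑ k) α α⁻¹)
        (trans (cong (w ↑ k ⊗_) (proj₂ (inverse α α≢𝟘))) (R.*-identityʳ _)))

      unique-B : ∀ {z B B′} → B ⊗ α ≡ z → B′ ⊗ α ≡ z → B ≡ B′
      unique-B {z} {B} {B′} e e′ = ⊗-cancelˡ α≢𝟘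
        (trans (R.*-comm α B) (trans e (trans (sym e′) (R.*-comm B′ α))))

      a≢ca : a ≢ c ⊗ a
      a≢ca e = c≢𝟙 (⊗-cancelˡ a≢𝟘 (trans (R.*-comm a c) (trans (sym e) (sym (R.*-identityʳ a)))))

      -- Two distinct solutions of this linear equation in `u` force `c ≡ w`, and then a = c a.
      unique-u : ∀ w {u u′} → c ⊗ u ⊕ a ≡ w ⊗ (u ⊕ a) → c ⊗ u′ ⊕ a ≡ w ⊗ (u′ ⊕ a) → u ≡ u′
      unique-u w {u} {u′} e e′ with difference u′ u
      ... | d , refl with d ≟ᶠ 𝟘
      ... | yes refl = sym (R.+-identityʳ u)
      ... | no d≢𝟘   = ⊥-elim (a≢ca (⊕-cancelˡ (c ⊗ u) _ _
        (trans e (trans (cong (_⊗ (u ⊕ a)) (sym c≡w)) (R.distribˡ c u a)))))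
        where
        c≡w : c ≡ w
        c≡w = ⊗-cancelˡ d≢𝟘 (⊕-cancelˡ (w ⊗ (u ⊕ a)) _ _
          (trans (cong (_⊕ d ⊗ c) (sym e))
          (trans (solve 4 (λ c u a d → (c :* u :+ a :+ d :* c) := (c :* (u :+ d) :+ a)) refl c u a d)
          (trans e′
                 (solve 4 (λ w u a d → (w :* (u :+ d :+ a)) := (w :* (u :+ a) :+ d :* w)) refl w u a d)))))

      ratio : ∀ u B → (u ⊕ a) ↑ k ≡ B ⊗ α → (c ⊗ u ⊕ a) ↑ k ≡ B ⊗ β →
              1 ≤ ∑[ w ∈ 𝔽 ] (r w * (s w u * t u B))
      ratio u B e e′ = ≤-trans (≤-reflexive (sym all-one)) (∑-≥ (λ w → r w * (s w u * t u B)) w)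
        where
        -- If u + a vanished, so would `B`, and with it c u + a; comparison with c (u + a) = 0 gives
        -- a = c a.
        u+a≢𝟘 : u ⊕ a ≢ 𝟘
        u+a≢𝟘 u+a≡𝟘 = a≢ca (⊕-cancelˡ (c ⊗ u) _ _ (trans
          (↑≡𝟘⇒≡𝟘 k (trans e′ (trans (cong (_⊗ β) B≡𝟘) (R.zeroˡ β))))
          (sym (trans (sym (R.distribˡ c u a)) (trans (cong (c ⊗_) u+a≡𝟘) (R.zeroʳ c))))))
          where
          B≡𝟘 : B ≡ 𝟘
          B≡𝟘 = ⊗-cancelˡ α≢𝟘 (trans (R.*-comm α B)
            (trans (sym e) (trans (cong (_↑ k) u+a≡𝟘) (trans (𝟘↑ k) (sym (R.zeroʳ α))))))
        B≢𝟘 : B ≢ 𝟘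
        B≢𝟘 refl = ↑-≢𝟘 k u+a≢𝟘 (trans e (R.zeroˡ α))
        i = proj₁ (inverse (u ⊕ a) u+a≢𝟘)
        w = (c ⊗ u ⊕ a) ⊗ i
        w[u+a] : w ⊗ (u ⊕ a) ≡ c ⊗ u ⊕ a
        w[u+a] = trans (R.*-assoc _ i (u ⊕ a))
          (trans (cong ((c ⊗ u ⊕ a) ⊗_) (trans (R.*-comm i _) (proj₂ (inverse (u ⊕ a) u+a≢𝟘))))
                 (R.*-identityʳ _))
        wᵏα≡β : w ↑ k ⊗ α ≡ β
        wᵏα≡β = ⊗-cancelˡ B≢𝟘 (trans
          (solve 3 (λ b p α → (b :* (p :* α)) := (p :* (b :* α))) refl B (w ↑ k) α)
          (trans (cong (w ↑ k ⊗_) (sym e))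
          (trans (sym (↑-⊗ w (u ⊕ a) k)) (trans (cong (_↑ k) w[u+a]) e′))))
        all-one : r w * (s w u * t u B) ≡ 1
        all-one = cong₂ _*_ (⟦⟧-true (w ↑ k ⊗ α ≟ᶠ β) wᵏα≡β)
          (cong₂ _*_ (⟦⟧-true (c ⊗ u ⊕ a ≟ᶠ w ⊗ (u ⊕ a)) (sym w[u+a]))
                     (⟦⟧-true (B ⊗ α ≟ᶠ (u ⊕ a) ↑ k) (sym e)))

    -- The ratio argument fails for `c ≡ 𝟙` or `α ≡ 𝟘` only, where the trivial bound `q` takes over.
    -- Written with indicators, it can be averaged over `c` and x.
    excess : K → K → ℕ
    excess c α = k + (⟦ c ≟ᶠ 𝟙 ⟧ * q + ⟦ α ≟ᶠ 𝟘 ⟧ * q)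

    special≤excess : ∀ c α β → special c α β ≤ excess c α
    special≤excess c α β with c ≟ᶠ 𝟙 | α ≟ᶠ 𝟘
    ... | no c≢𝟙 | no α≢𝟘 = ≤-trans (special≤k c α β α≢𝟘 c≢𝟙) (m≤m+n k _)
    ... | yes _  | _      = ≤-trans (special≤q c α β)
      (≤-trans (≤-reflexive (sym (*-identityˡ q))) (≤-trans (m≤m+n (1 * q) _) (m≤n+m _ k)))
    ... | no _   | yes _  = ≤-trans (special≤q c α β)
      (≤-trans (≤-reflexive (sym (*-identityˡ q))) (m≤n+m _ k))

    -- Both terms are nonnegative, so one bound serves all pairs: the generic term also stands for
    -- dependent pairs, completing `∑-generic`. Summing over all ratios, rather than choosing one,
    -- lets the sum over `y` be taken first for each fixed `c`.
    pairs-bound : ∀ {n} (x y : Vec K (suc n)) →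
      q * (q * pairs x y) ≤ q ^ suc n * generic (prod x) (prod y) +
        ∑[ c ∈ 𝔽 ] (⟦ powers y ≟ᵛ c ∙ powers x ⟧ * (q * (q ^ suc n * excess c (prod x))))
    pairs-bound {n} x y with zero-or-nonzero x
    ... | inj₁ refl = ≤-trans (≤-reflexive (trans (cong (λ s → q * (q * s)) (pairs-𝟎 y))
                        (trans (cong (q *_) (*-zeroʳ q)) (*-zeroʳ q)))) z≤n
    ... | inj₂ x≢𝟎 with jointly-uniform (powers-nonzero x≢𝟎) (powers y)
    ... | inj₂ uniform = ≤-trans (≤-reflexive (pairs-generic x y uniform)) (m≤m+n _ _)
    ... | inj₁ (c , e) = begin
      q * (q * pairs x y)
        ≡⟨ cong (q *_) (pairs-special x y c x≢𝟎 e) ⟩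
      q * (q ^ suc n * special c (prod x) (prod y))
        ≤⟨ *-monoʳ-≤ q (*-monoʳ-≤ (q ^ suc n) (special≤excess c (prod x) (prod y))) ⟩
      b c
        ≡⟨ sym (trans (cong (_* b c) (⟦⟧-true (powers y ≟ᵛ c ∙ powers x) e)) (*-identityˡ (b c))) ⟩
      ⟦ powers y ≟ᵛ c ∙ powers x ⟧ * b c
        ≤⟨ ∑-≥ (λ c → ⟦ powers y ≟ᵛ c ∙ powers x ⟧ * b c) c ⟩
      ∑[ c ∈ 𝔽 ] (⟦ powers y ≟ᵛ c ∙ powers x ⟧ * b c)
        ≤⟨ m≤n+m _ _ ⟩
      q ^ suc n * generic (prod x) (prod y) + ∑[ c ∈ 𝔽 ] (⟦ powers y ≟ᵛ c ∙ powers x ⟧ * b c) ∎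
      where
      open ≤-Reasoning
      b : K → ℕ
      b c = q * (q ^ suc n * excess c (prod x))

    -- Counting dependent pairs

    fibre-∷ : ∀ {n} z (Z : Vec K n) →
      ∑[ y ∈ 𝔽^ (suc n) ] ⟦ powers y ≟ᵛ z ∷ Z ⟧ ≤ m * ∑[ y ∈ 𝔽^ n ] ⟦ powers y ≟ᵛ Z ⟧
    fibre-∷ {n} z Z = begin
      ∑[ y ∈ 𝔽^ (suc n) ] ⟦ powers y ≟ᵛ z ∷ Z ⟧
        ≡⟨ trans (∑-∷ {n} _) (∑-cong 𝔽 λ y → ∑-cong (𝔽^ n) λ v → ⟦∷⟧ (y ↑ m) z (powers v) Z) ⟩
      ∑[ y ∈ 𝔽 ] ∑[ v ∈ 𝔽^ n ] (⟦ y ↑ m ≟ᶠ z ⟧ * ⟦ powers v ≟ᵛ Z ⟧)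
        ≡⟨ sym (∑-* 𝔽 (𝔽^ n) _ _) ⟩
      ∑[ y ∈ 𝔽 ] ⟦ y ↑ m ≟ᶠ z ⟧ * ∑[ v ∈ 𝔽^ n ] ⟦ powers v ≟ᵛ Z ⟧
        ≤⟨ *-monoˡ-≤ _ (↑-roots m z) ⟩
      m * ∑[ v ∈ 𝔽^ n ] ⟦ powers v ≟ᵛ Z ⟧ ∎
      where open ≤-Reasoning

    fibre : ∀ {n} (Z : Vec K n) → ∑[ y ∈ 𝔽^ n ] ⟦ powers y ≟ᵛ Z ⟧ ≤ m ^ n
    fibre []      = ≤-refl
    fibre (z ∷ Z) = ≤-trans (fibre-∷ z Z) (*-monoʳ-≤ m (fibre Z))

    -- Bounding only three coordinates by m and the others by q gives a better
    -- dependence on m than mⁿ.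
    fibre₃ : ∀ {l} (Z : Vec K (3 + l)) → ∑[ y ∈ 𝔽^ (3 + l) ] ⟦ powers y ≟ᵛ Z ⟧ ≤ m * (m * (m * q ^ l))
    fibre₃ {l} (z₁ ∷ z₂ ∷ z₃ ∷ Z) =
      ≤-trans (fibre-∷ z₁ (z₂ ∷ z₃ ∷ Z)) (*-monoʳ-≤ m (
      ≤-trans (fibre-∷ z₂ (z₃ ∷ Z)) (*-monoʳ-≤ m (
      ≤-trans (fibre-∷ z₃ Z) (*-monoʳ-≤ m (
      ≤-trans (∑-mono (𝔽^ l) λ v → ⟦⟧≤1 (powers v ≟ᵛ Z))
              (≤-reflexive (trans (∑𝔽^-const l 1) (*-identityʳ _)))))))))

    ∑-excess : ∀ n → ∑[ x ∈ 𝔽^ n ] ∑[ c ∈ 𝔽 ] excess c (prod x) ≤ q ^ n * (q * (k + 1 + n))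
    ∑-excess n = begin
      ∑[ x ∈ 𝔽^ n ] ∑[ c ∈ 𝔽 ] excess c (prod x)
        ≡⟨ ∑-cong (𝔽^ n) (λ x → trans (∑-+ 𝔽 _ _) (cong₂ _+_ (∑𝔽-const k) (trans (∑-+ 𝔽 _ _)
             (cong₂ _+_ (∑-δ 𝟙 λ _ → q) (∑𝔽-const _))))) ⟩
      ∑[ x ∈ 𝔽^ n ] (q * k + (q + q * (⟦ prod x ≟ᶠ 𝟘 ⟧ * q)))
        ≡⟨ trans (∑-+ (𝔽^ n) _ _) (cong₂ _+_ (∑𝔽^-const n _) (trans (∑-+ (𝔽^ n) _ _) (cong₂ _+_ (∑𝔽^-const n q)
             (trans (∑-*ˡ (𝔽^ n) q _) (cong (q *_) (∑-*ʳ (𝔽^ n) q _)))))) ⟩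
      q ^ n * (q * k) + (q ^ n * q + q * (Z * q))
        ≡⟨ cong (λ t → q ^ n * (q * k) + (q ^ n * q + q * t)) (*-comm Z q) ⟩
      q ^ n * (q * k) + (q ^ n * q + q * (q * Z))
        ≤⟨ +-monoʳ-≤ (q ^ n * (q * k)) (+-monoʳ-≤ (q ^ n * q) (*-monoʳ-≤ q (prod-zeros n))) ⟩
      q ^ n * (q * k) + (q ^ n * q + q * (n * q ^ n))
        ≡⟨ collect (q ^ n) q k n ⟩
      q ^ n * (q * (k + 1 + n)) ∎
      where
      open ≤-Reasoning
      Z = ∑[ x ∈ 𝔽^ n ] ⟦ prod x ≟ᶠ 𝟘 ⟧
      collect : ∀ s q k n → s * (q * k) + (s * q + q * (n * s)) ≡ s * (q * (k + 1 + n))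
      collect = solve-∀

    -- Second moment and variance

    ∑-N² : ∀ n → ∑[ A ∈ 𝔽^ n ] ∑[ B ∈ 𝔽 ] (N A B * N A B) ≡ ∑[ x ∈ 𝔽^ n ] ∑[ y ∈ 𝔽^ n ] pairs x y
    ∑-N² n = begin
      ∑[ A ∈ V ] ∑[ B ∈ 𝔽 ] (N A B * N A B)
        ≡⟨ ∑-cong V (λ A → ∑-cong 𝔽 λ B → ∑-* V V (χ A B) (χ A B)) ⟩
      ∑[ A ∈ V ] ∑[ B ∈ 𝔽 ] ∑[ x ∈ V ] ∑[ y ∈ V ] (χ A B x * χ A B y)
        ≡⟨ ∑-cong V (λ A → trans (∑-swap 𝔽 V _) (∑-cong V λ x → ∑-swap 𝔽 V _)) ⟩
      ∑[ A ∈ V ] ∑[ x ∈ V ] ∑[ y ∈ V ] ∑[ B ∈ 𝔽 ] (χ A B x * χ A B y)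
        ≡⟨ trans (∑-swap V V _) (∑-cong V λ x → ∑-swap V V _) ⟩
      ∑[ x ∈ V ] ∑[ y ∈ V ] pairs x y ∎
      where
      open ≡-Reasoning
      V = 𝔽^ n

    second-moment : ∀ l → let n = 3 + l; s = q ^ n in
      q * (q * ∑[ A ∈ 𝔽^ n ] ∑[ B ∈ 𝔽 ] (N A B * N A B)) ≤
        s * (q * (s * s)) + m * (m * (m * q ^ l)) * (q * (s * (s * (q * (k + 1 + n)))))
    second-moment l = begin
      q * (q * ∑[ A ∈ V ] ∑[ B ∈ 𝔽 ] (N A B * N A B))
        ≡⟨ cong (λ t → q * (q * t)) (∑-N² n) ⟩
      q * (q * ∑[ x ∈ V ] ∑[ y ∈ V ] pairs x y)
        ≡⟨ sym (trans (∑-cong V λ x → ∑q² (pairs x)) (∑q² _)) ⟩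
      ∑[ x ∈ V ] ∑[ y ∈ V ] (q * (q * pairs x y))
        ≤⟨ ∑-mono V (λ x → ∑-mono V λ y → pairs-bound x y) ⟩
      ∑[ x ∈ V ] ∑[ y ∈ V ] (s * generic (prod x) (prod y) + ∑[ c ∈ 𝔽 ] (⟦ powers y ≟ᵛ c ∙ powers x ⟧ * b x c))
        ≡⟨ trans (∑-cong V λ x → trans (∑-+ V _ _) (cong₂ _+_ (∑-*ˡ V s _) (∑-swap V 𝔽 _))) (∑-+ V _ _) ⟩
      ∑[ x ∈ V ] (s * ∑[ y ∈ V ] generic (prod x) (prod y)) +
      ∑[ x ∈ V ] ∑[ c ∈ 𝔽 ] ∑[ y ∈ V ] (⟦ powers y ≟ᵛ c ∙ powers x ⟧ * b x c)
        ≤⟨ +-mono-≤ (≤-reflexive (trans (∑-*ˡ V s _) (cong (s *_) (∑-generic (2 + l)))))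
             (∑-mono V λ x → ∑-mono 𝔽 λ c → ≤-trans (≤-reflexive (∑-*ʳ V (b x c) _))
               (*-monoˡ-≤ (b x c) (fibre₃ (c ∙ powers x)))) ⟩
      s * (q * (s * s)) + ∑[ x ∈ V ] ∑[ c ∈ 𝔽 ] (F * b x c)
        ≡⟨ cong (s * (q * (s * s)) +_) (trans (∑-cong V λ x → trans (∑-*ˡ 𝔽 F _) (cong (F *_)
             (trans (∑-*ˡ 𝔽 q _) (cong (q *_) (∑-*ˡ 𝔽 s _))))) (trans (∑-*ˡ V F _) (cong (F *_)
             (trans (∑-*ˡ V q _) (cong (q *_) (∑-*ˡ V s _)))))) ⟩
      s * (q * (s * s)) + F * (q * (s * ∑[ x ∈ V ] ∑[ c ∈ 𝔽 ] excess c (prod x)))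
        ≤⟨ +-monoʳ-≤ (s * (q * (s * s))) (*-monoʳ-≤ F (*-monoʳ-≤ q (*-monoʳ-≤ s (∑-excess n)))) ⟩
      s * (q * (s * s)) + F * (q * (s * (s * (q * (k + 1 + n))))) ∎
      where
      open ≤-Reasoning
      n = 3 + l
      s = q ^ n
      V = 𝔽^ n
      F = m * (m * (m * q ^ l))
      b : Vec K n → K → ℕ
      b x c = q * (s * excess c (prod x))
      ∑q² : ∀ f → ∑[ x ∈ V ] (q * (q * f x)) ≡ q * (q * ∑ V f)
      ∑q² f = trans (∑-*ˡ V q _) (cong (q *_) (∑-*ˡ V q f))

    deviation² : ∀ {n} → ℕ → Vec K n → K → ℕ
    deviation² M A B = ∣ N A B - M ∣ * ∣ N A B - M ∣

    variance : ∀ l → 2 ≤ m → let n = 3 + l; M = q ^ (2 + l) in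
      ∑[ A ∈ 𝔽^ n ] ∑[ B ∈ 𝔽 ] deviation² M A B ≤
        q ^ n * q ^ n * (m * (m * (m * q ^ l)) * (k + 2 + n))
    -- After multiplication by q², the sums of N², M² and -2NM have main terms q s³, q s³ and -2 q
    -- s³. Adding 2 q s³ to both sides performs the cancellation without subtraction.
    variance l 2≤m = *-cancelˡ-≤ q (*-cancelˡ-≤ q (+-cancelʳ-≤ (2 * (q * (s * (s * s)))) _ _ (begin
      q * (q * Var) + 2 * (q * (s * (s * s)))
        ≤⟨ +-monoʳ-≤ (q * (q * Var)) (*-monoʳ-≤ 2 (*-monoʳ-≤ q (*-monoʳ-≤ s (∑N-lower n)))) ⟩
      q * (q * Var) + 2 * (q * (s * (∑N + s)))
        ≡⟨ regroup q Var M ∑N ⟩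
      q * (q * (Var + 2 * (∑N * M))) + 2 * (q * (s * s))
        ≡⟨ cong (λ t → q * (q * t) + 2 * (q * (s * s))) moments ⟩
      q * (q * (∑N² + s * (q * (M * M)))) + 2 * (q * (s * s))
        ≡⟨ cong (_+ 2 * (q * (s * s))) (regroup′ q ∑N² M) ⟩
      q * (q * ∑N²) + q * (s * (s * s)) + 2 * (q * (s * s))
        -- The leftover 2 q s² comes from x = 0 in the mean. It is absorbed by F q² s², since 2 ≤ m
        -- ≤ F, which raises `k + 1 + n` to `k + 2 + n`.
        ≤⟨ +-mono-≤ (+-monoˡ-≤ (q * (s * (s * s))) (second-moment l)) (*-mono-≤ 2≤F (m≤n*m (q * (s * s)) q)) ⟩
      s * (q * (s * s)) + F * (q * (s * (s * (q * (k + 1 + n))))) + q * (s * (s * s)) + F * (q * (q * (s * s)))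
        ≡⟨ regroup″ q s F k n ⟩
      q * (q * (s * s * (F * (k + 2 + n)))) + 2 * (q * (s * (s * s))) ∎)))
      where
      open ≤-Reasoning
      n = 3 + l
      M = q ^ (2 + l)
      s = q ^ n
      V = 𝔽^ n
      F = m * (m * (m * q ^ l))
      Var = ∑[ A ∈ V ] ∑[ B ∈ 𝔽 ] deviation² M A B
      ∑N  = ∑[ A ∈ V ] ∑[ B ∈ 𝔽 ] N A B
      ∑N² = ∑[ A ∈ V ] ∑[ B ∈ 𝔽 ] (N A B * N A B)
      instance
        qˡ-nonZero : NonZero (q ^ l)
        qˡ-nonZero = m^n≢0 q l
        mqˡ-nonZero : NonZero (m * q ^ l)
        mqˡ-nonZero = m*n≢0 m (q ^ l)
        mmqˡ-nonZero : NonZero (m * (m * q ^ l))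
        mmqˡ-nonZero = m*n≢0 m (m * q ^ l)
      2≤F : 2 ≤ F
      2≤F = ≤-trans 2≤m (m≤m*n m (m * (m * q ^ l)))
      moments : Var + 2 * (∑N * M) ≡ ∑N² + s * (q * (M * M))
      moments = begin-equality
        Var + 2 * (∑N * M)
          ≡⟨ cong (Var +_) (sym (trans
               (∑-cong V λ A → trans (∑-*ˡ 𝔽 2 _) (cong (2 *_) (∑-*ʳ 𝔽 M _)))
               (trans (∑-*ˡ V 2 _) (cong (2 *_) (∑-*ʳ V M _))))) ⟩
        Var + ∑[ A ∈ V ] ∑[ B ∈ 𝔽 ] (2 * (N A B * M))
          ≡⟨ sym (trans (∑-cong V λ A → ∑-+ 𝔽 _ _) (∑-+ V _ _)) ⟩
        ∑[ A ∈ V ] ∑[ B ∈ 𝔽 ] (deviation² M A B + 2 * (N A B * M))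
          ≡⟨ ∑-cong V (λ A → ∑-cong 𝔽 λ B → ∣-∣-square (N A B) M) ⟩
        ∑[ A ∈ V ] ∑[ B ∈ 𝔽 ] (N A B * N A B + M * M)
          ≡⟨ trans (∑-cong V λ A → ∑-+ 𝔽 _ _) (∑-+ V _ _) ⟩
        ∑N² + ∑[ A ∈ V ] ∑[ B ∈ 𝔽 ] (M * M)
          ≡⟨ cong (∑N² +_) (trans (∑-cong V λ A → ∑𝔽-const _) (∑𝔽^-const n _)) ⟩
        ∑N² + s * (q * (M * M)) ∎
      regroup : ∀ q v M e → q * (q * v) + 2 * (q * (q * M * (e + q * M)))
                            ≡ q * (q * (v + 2 * (e * M))) + 2 * (q * (q * M * (q * M)))
      regroup = solve-∀
      regroup′ : ∀ q e M → q * (q * (e + q * M * (q * (M * M)))) ≡ q * (q * e) + q * (q * M * (q * M * (q * M)))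
      regroup′ = solve-∀
      regroup″ : ∀ q s F k n →
        s * (q * (s * s)) + F * (q * (s * (s * (q * (k + 1 + n))))) + q * (s * (s * s)) + F * (q * (q * (s * s)))
        ≡ q * (q * (s * s * (F * (k + 2 + n)))) + 2 * (q * (s * (s * s)))
      regroup″ = solve-∀

    -- The torus action on the coefficients

    infixl 7 _⊙_
    _⊙_ : ∀ {n} → Vec K n → Vec K n → Vec K n
    _⊙_ = zipWithᵛ _⊗_

    Units : ∀ {n} → Vec K n → Set
    Units = All (_≢ 𝟘)

    units? : ∀ {n} (t : Vec K n) → Dec (Units t)
    units? = all? λ x → ¬? (x ≟ᶠ 𝟘)

    ∑-⊙ : ∀ {n} {t : Vec K n} → Units t → ∀ (f : Vec K n → ℕ) → ∑[ x ∈ 𝔽^ n ] f (t ⊙ x) ≡ ∑ (𝔽^ n) f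
    ∑-⊙ []                    f = refl
    ∑-⊙ {suc n} {t ∷ ts} (t≢𝟘 ∷ us) f = begin
      ∑[ x ∈ 𝔽^ (suc n) ] f ((t ∷ ts) ⊙ x)              ≡⟨ ∑-∷ {n} _ ⟩
      ∑[ x ∈ 𝔽 ] ∑[ v ∈ 𝔽^ n ] f (t ⊗ x ∷ ts ⊙ v)       ≡⟨ ∑-cong 𝔽 (λ x → ∑-⊙ us λ v → f (t ⊗ x ∷ v)) ⟩
      ∑[ x ∈ 𝔽 ] ∑[ v ∈ 𝔽^ n ] f (t ⊗ x ∷ v)            ≡⟨ ∑-scale t≢𝟘 (λ x → ∑[ v ∈ 𝔽^ n ] f (x ∷ v)) ⟩
      ∑[ x ∈ 𝔽 ] ∑[ v ∈ 𝔽^ n ] f (x ∷ v)                ≡⟨ sym (∑-∷ {n} f) ⟩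
      ∑ (𝔽^ (suc n)) f                                  ∎
      where open ≡-Reasoning

    prod-⊙ : ∀ {n} (t x : Vec K n) → prod (t ⊙ x) ≡ prod t ⊗ prod x
    prod-⊙ []      []      = sym (R.*-identityˡ 𝟙)
    prod-⊙ (t ∷ s) (x ∷ v) = trans (cong (t ⊗ x ⊗_) (prod-⊙ s v))
      (solve 4 (λ t x a b → (t :* x :* (a :* b)) := (t :* a :* (x :* b))) refl t x (prod s) (prod v))

    dot-⊙ : ∀ {n} (A t x : Vec K n) → dot A (powers (t ⊙ x)) ≡ dot (A ⊙ powers t) (powers x)
    dot-⊙ []      []      []      = refl
    dot-⊙ (b ∷ A) (t ∷ s) (x ∷ v) = cong₂ _⊕_
      (trans (cong (b ⊗_) (↑-⊗ t x m)) (sym (R.*-assoc b (t ↑ m) (x ↑ m)))) (dot-⊙ A s v)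

    N-invariant : ∀ {n} (A : Vec K n) B {t} → Units t → N (A ⊙ powers t) (B ⊗ prod t) ≡ N A B
    N-invariant {n} A B {t} us = trans
      (∑-cong (𝔽^ n) λ x → cong₂ (λ u r → ⟦ (u ⊕ a) ↑ k ≟ᶠ r ⟧) (sym (dot-⊙ A t x))
        (trans (R.*-assoc B (prod t) (prod x)) (cong (B ⊗_) (sym (prod-⊙ t x)))))
      (∑-⊙ us (χ A B))

    -- `W` is the coordinatewise quotient of `Z` by `A`; it confines the parameters `t` leading to a
    -- given `A′` to one fibre of `powers`.
    ⊙-solution : ∀ {n} {A : Vec K n} → Units A → ∀ Z → ∃ λ W → ∀ P → Z ≡ A ⊙ P → P ≡ W
    ⊙-solution []       []      = [] , λ { [] _ → refl }
    ⊙-solution {A = b ∷ _} (b≢𝟘 ∷ us) (z ∷ Z) with inverse b b≢𝟘 | ⊙-solution us Z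
    ... | i , bi≡𝟙 | W , solve-W = i ⊗ z ∷ W , λ { (p ∷ P) e →
      let z≡bp , Z≡AP = ∷-injective e in
      cong₂ _∷_ (sym (trans (cong (i ⊗_) z≡bp) (trans (sym (R.*-assoc i b p))
        (trans (cong (_⊗ p) (trans (R.*-comm i b) bi≡𝟙)) (R.*-identityˡ p))))) (solve-W P Z≡AP) }

    -- The new coefficient vector alone determines tᵐ, so at most mⁿ parameters lead to it. The
    -- accompanying value of `B` is absorbed by summing over the whole row.
    orbit-sum : ∀ {n} {A : Vec K n} → Units A → ∀ B (f : Vec K n → K → ℕ) →
      ∑[ t ∈ 𝔽^ n ] f (A ⊙ powers t) (B ⊗ prod t) ≤ m ^ n * ∑[ A′ ∈ 𝔽^ n ] ∑[ B′ ∈ 𝔽 ] f A′ B′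
    orbit-sum {n} {A} us B f = begin
      ∑[ t ∈ V ] f (A ⊙ powers t) (B ⊗ prod t)
        ≤⟨ ∑-mono V (λ t → ∑-≥ (f (A ⊙ powers t)) (B ⊗ prod t)) ⟩
      ∑[ t ∈ V ] row (A ⊙ powers t)
        ≡⟨ ∑-cong V (λ t → sym (∑-δᵛ (A ⊙ powers t) row)) ⟩
      ∑[ t ∈ V ] ∑[ A′ ∈ V ] (⟦ A′ ≟ᵛ A ⊙ powers t ⟧ * row A′)
        ≡⟨ trans (∑-swap V V _) (∑-cong V λ A′ → ∑-*ʳ V (row A′) _) ⟩
      ∑[ A′ ∈ V ] (∑[ t ∈ V ] ⟦ A′ ≟ᵛ A ⊙ powers t ⟧ * row A′)
        ≤⟨ ∑-mono V (λ A′ → *-monoˡ-≤ (row A′) (orbit-fibre A′)) ⟩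
      ∑[ A′ ∈ V ] (m ^ n * row A′)
        ≡⟨ ∑-*ˡ V (m ^ n) row ⟩
      m ^ n * ∑ V row ∎
      where
      open ≤-Reasoning
      V = 𝔽^ n
      row : Vec K n → ℕ
      row A′ = ∑[ B′ ∈ 𝔽 ] f A′ B′
      orbit-fibre : ∀ A′ → ∑[ t ∈ V ] ⟦ A′ ≟ᵛ A ⊙ powers t ⟧ ≤ m ^ n
      orbit-fibre A′ with ⊙-solution us A′
      ... | W , unique = ≤-trans
        (∑-mono V λ t → ⟦⟧-mono (A′ ≟ᵛ A ⊙ powers t) (powers t ≟ᵛ W) (unique (powers t))) (fibre W)

    -- The unit `𝟙` makes up for the single non-unit `𝟘`. This is the source of the factor 2ⁿ.
    units-half : q ≤ 2 * ∑[ x ∈ 𝔽 ] ⟦ ¬? (x ≟ᶠ 𝟘) ⟧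
    units-half = begin
      q                              ≡⟨ sym (trans (∑𝔽-const 1) (*-identityʳ q)) ⟩
      ∑[ x ∈ 𝔽 ] 1                   ≡⟨ ∑-cong 𝔽 split ⟩
      ∑[ x ∈ 𝔽 ] (⟦ x ≟ᶠ 𝟘 ⟧ + u x)  ≡⟨ ∑-+ 𝔽 _ u ⟩
      ∑[ x ∈ 𝔽 ] ⟦ x ≟ᶠ 𝟘 ⟧ + ∑ 𝔽 u  ≡⟨ cong (_+ ∑ 𝔽 u) (∑-one 𝟘) ⟩
      1 + ∑ 𝔽 u                      ≤⟨ +-monoˡ-≤ (∑ 𝔽 u) (≤-trans (≤-reflexive (sym (⟦⟧-true (¬? (𝟙 ≟ᶠ 𝟘)) 𝟙≢𝟘)))
                                          (∑-≥ u 𝟙)) ⟩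
      ∑ 𝔽 u + ∑ 𝔽 u                  ≡⟨ cong (∑ 𝔽 u +_) (sym (+-identityʳ _)) ⟩
      2 * ∑ 𝔽 u                      ∎
      where
      open ≤-Reasoning
      u : K → ℕ
      u x = ⟦ ¬? (x ≟ᶠ 𝟘) ⟧
      split : ∀ x → 1 ≡ ⟦ x ≟ᶠ 𝟘 ⟧ + u x
      split x with x ≟ᶠ 𝟘
      ... | yes _ = refl
      ... | no _  = refl

    units-many : ∀ n → q ^ n ≤ 2 ^ n * ∑[ t ∈ 𝔽^ n ] ⟦ units? t ⟧
    units-many zero    = ≤-refl
    units-many (suc n) = begin
      q * q ^ n
        ≤⟨ *-mono-≤ units-half (units-many n) ⟩
      2 * ∑ 𝔽 u * (2 ^ n * ∑[ t ∈ 𝔽^ n ] ⟦ units? t ⟧)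
        ≡⟨ *-interchange 2 (∑ 𝔽 u) (2 ^ n) _ ⟩
      2 * 2 ^ n * (∑ 𝔽 u * ∑[ t ∈ 𝔽^ n ] ⟦ units? t ⟧)
        ≡⟨ cong (2 ^ suc n *_) (trans (∑-* 𝔽 (𝔽^ n) u _) (trans
             (∑-cong 𝔽 λ x → ∑-cong (𝔽^ n) λ t → sym (units-∷ x t)) (sym (∑-∷ {n} _)))) ⟩
      2 ^ suc n * ∑[ t ∈ 𝔽^ (suc n) ] ⟦ units? t ⟧ ∎
      where
      open ≤-Reasoning
      u : K → ℕ
      u x = ⟦ ¬? (x ≟ᶠ 𝟘) ⟧
      *-interchange : ∀ a b c d → a * b * (c * d) ≡ a * c * (b * d)
      *-interchange = solve-∀
      units-∷ : ∀ x (t : Vec K n) → ⟦ units? (x ∷ t) ⟧ ≡ u x * ⟦ units? t ⟧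
      units-∷ x t with x ≟ᶠ 𝟘 | units? t
      ... | yes _ | yes _ = refl
      ... | yes _ | no _  = refl
      ... | no _  | yes _ = refl
      ... | no _  | no _  = refl

    deviation-bound : ∀ l → 2 ≤ m → let n = 3 + l in (A : Vec K n) → Units A → ∀ B →
      deviation² (q ^ (2 + l)) A B ≤ 2 ^ n * m ^ n * (q ^ n * (m * (m * (m * q ^ l)) * (k + 2 + n)))
    deviation-bound l 2≤m A us B = *-cancelˡ-≤ (q ^ n) {{m^n≢0 q n}} (begin
      q ^ n * D
        ≤⟨ *-monoˡ-≤ D (units-many n) ⟩
      2 ^ n * ∑[ t ∈ V ] ⟦ units? t ⟧ * D
        ≡⟨ trans (*-assoc (2 ^ n) _ D) (cong (2 ^ n *_) (sym (∑-*ʳ V D _))) ⟩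
      2 ^ n * ∑[ t ∈ V ] (⟦ units? t ⟧ * D)
        -- Invariance is used for unit vectors; all other `t` only add nonnegative terms.
        ≤⟨ *-monoʳ-≤ (2 ^ n) (∑-mono V λ t → ⟦⟧*-≤ (units? t) λ ut →
             ≤-reflexive (cong (λ N → ∣ N - q ^ (2 + l) ∣ * ∣ N - q ^ (2 + l) ∣) (sym (N-invariant A B ut)))) ⟩
      2 ^ n * ∑[ t ∈ V ] deviation² (q ^ (2 + l)) (A ⊙ powers t) (B ⊗ prod t)
        ≤⟨ *-monoʳ-≤ (2 ^ n) (orbit-sum us B (deviation² (q ^ (2 + l)))) ⟩
      2 ^ n * (m ^ n * ∑[ A′ ∈ V ] ∑[ B′ ∈ 𝔽 ] deviation² (q ^ (2 + l)) A′ B′)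
        ≤⟨ *-monoʳ-≤ (2 ^ n) (*-monoʳ-≤ (m ^ n) (variance l 2≤m)) ⟩
      2 ^ n * (m ^ n * (q ^ n * q ^ n * (m * (m * (m * q ^ l)) * (k + 2 + n))))
        ≡⟨ regroup (2 ^ n) (m ^ n) (q ^ n) (m * (m * (m * q ^ l)) * (k + 2 + n)) ⟩
      q ^ n * (2 ^ n * m ^ n * (q ^ n * (m * (m * (m * q ^ l)) * (k + 2 + n)))) ∎)
      where
      open ≤-Reasoning
      n = 3 + l
      V = 𝔽^ n
      D = deviation² (q ^ (2 + l)) A B
      regroup : ∀ a b s c → a * (b * (s * s * c)) ≡ s * (a * b * (s * c))
      regroup = solve-∀

-- Transport from an abstract finite field

module Transport {c ℓ : Level} (F : FiniteField c ℓ) where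
  private
    module F = FiniteField F
    module O = FieldOps F

  index : F.Carrier → Fin F.q
  index x = proj₁ (F.elem-sur x)

  elem-index : ∀ x → F.elem (index x) F.≈ x
  elem-index x = proj₂ (F.elem-sur x)

  rawRing : RawRing 0ℓ 0ℓ
  rawRing = record
    { Carrier = Fin F.q
    ; _≈_     = _≡_
    ; _+_     = λ i j → index (F.elem i F.+ F.elem j)
    ; _*_     = λ i j → index (F.elem i F.* F.elem j)
    ; -_      = λ i → index (F.- F.elem i)
    ; 0#      = index F.0#
    ; 1#      = index F.1#
    }

  elem-isRingMonomorphism : IsRingMonomorphism rawRing F.rawRing F.elem
  elem-isRingMonomorphism = record
    { isRingHomomorphism = record
      { isSemiringHomomorphism = record
        { isNearSemiringHomomorphism = record
          { +-isMonoidHomomorphism = record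
            { isMagmaHomomorphism = record
              { isRelHomomorphism = record { cong = λ { refl → F.refl } }
              ; homo = λ i j → elem-index _
              }
            ; ε-homo = elem-index _
            }
          ; *-homo = λ i j → elem-index _
          }
        ; 1#-homo = elem-index _
        }
      ; -‿homo = λ i → elem-index _
      }
    ; injective = F.elem-inj _ _
    }

  index-cong : ∀ {x y} → x F.≈ y → index x ≡ index y
  index-cong x≈y = F.elem-inj _ _ (F.trans (elem-index _) (F.trans x≈y (F.sym (elem-index _))))

  index-≢ : ∀ {x y} → ¬ x F.≈ y → index x ≢ index y
  index-≢ x≉y e = x≉y (F.trans (F.sym (elem-index _)) (F.trans (F.reflexive (cong F.elem e)) (elem-index _)))

  fieldOn : FieldOn F.q
  fieldOn = record
    { isCommutativeRing = RingMonomorphism.isCommutativeRing elem-isRingMonomorphism F.isCommutativeRing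
    ; 𝟙≢𝟘               = index-≢ F.1≉0
    ; inverse           = λ i i≢𝟘 →
        let y , iy≈1 = F.inverse (F.elem i) λ i≈0 →
                         i≢𝟘 (F.elem-inj _ _ (F.trans i≈0 (F.sym (elem-index _))))
        in index y , index-cong (F.trans (F.*-congˡ (elem-index y)) iy≈1)
    }

  open FieldOn fieldOn
  open Counting fieldOn

  elem-⊕ : ∀ {i j x y} → F.elem i F.≈ x → F.elem j F.≈ y → F.elem (i ⊕ j) F.≈ x F.+ y
  elem-⊕ e e′ = F.trans (elem-index _) (F.+-cong e e′)

  elem-⊗ : ∀ {i j x y} → F.elem i F.≈ x → F.elem j F.≈ y → F.elem (i ⊗ j) F.≈ x F.* y
  elem-⊗ e e′ = F.trans (elem-index _) (F.*-cong e e′)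

  elem-↑ : ∀ {i x} n → F.elem i F.≈ x → F.elem (i ↑ n) F.≈ O.pow x n
  elem-↑ zero    e = elem-index _
  elem-↑ (suc n) e = elem-⊗ e (elem-↑ n e)

  elem-prod : ∀ n (f : Fin n → Fin F.q) → F.elem (prod (tabulateᵛ f)) F.≈ O.prodF n (λ i → F.elem (f i))
  elem-prod zero    f = elem-index _
  elem-prod (suc n) f = elem-⊗ F.refl (elem-prod n (f ∘ suc))

  elem-dot : ∀ n m (as : Fin n → F.Carrier) (f : Fin n → Fin F.q) →
    F.elem (dot (tabulateᵛ (index ∘ as)) (mapᵛ (_↑ m) (tabulateᵛ f)))
      F.≈ O.sumF n (λ i → as i F.* O.pow (F.elem (f i)) m)
  elem-dot zero    m as f = elem-index _
  elem-dot (suc n) m as f =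
    elem-⊕ (elem-⊗ (elem-index _) (elem-↑ m F.refl)) (elem-dot n m (as ∘ suc) (f ∘ suc))

  -- `tabulateᵛ (consF i f)` reduces to `i ∷ tabulateᵛ f`, so the recursion over functions follows
  -- the one over vectors without function extensionality.
  countTuples-∑ : ∀ n (P : (Fin n → Fin F.q) → Bool) (h : Vec K n → ℕ) →
    (∀ f → (if P f then 1 else 0) ≡ h (tabulateᵛ f)) → O.countTuples n P ≡ ∑ (𝔽^ n) h
  countTuples-∑ zero    P h e = trans (e _) (sym (+-identityʳ _))
  countTuples-∑ (suc n) P h e = trans
    (∑-cong 𝔽 λ i → countTuples-∑ n (λ f → P (O.consF i f)) (λ v → h (i ∷ v)) λ f → e (O.consF i f))
    (sym (∑-∷ {n} h))

  units-tabulate : ∀ n (as : Fin n → F.Carrier) → (∀ i → ¬ as i F.≈ F.0#) →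
                   All (_≢ 𝟘) (tabulateᵛ (index ∘ as))
  units-tabulate zero    as as≉0 = []
  units-tabulate (suc n) as as≉0 = index-≢ (as≉0 zero) ∷ units-tabulate n (as ∘ suc) (as≉0 ∘ suc)

  module _ (k m : ℕ) .{{_ : NonZero k}} .{{_ : NonZero m}} (a : F.Carrier) (a≉0 : ¬ a F.≈ F.0#) where
    open Equation k m (index a) (index-≢ a≉0) public

    numSolutions-N : ∀ n (b : F.Carrier) (as : Fin n → F.Carrier) →
      O.numSolutions n m k a b as ≡ N (tabulateᵛ (index ∘ as)) (index b)
    numSolutions-N n b as = countTuples-∑ n _ (χ A (index b)) λ f →
      let lhs = elem-↑ k (elem-⊕ (elem-dot n m as f) (elem-index a))
          rhs = elem-⊗ (elem-index b) (elem-prod n f)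
      in ⟦⟧-cong (_ F.≟ _) (_ ≟ᶠ _)
           (λ e → F.elem-inj _ _ (F.trans lhs (F.trans e (F.sym rhs))))
           (λ e → F.trans (F.sym lhs) (F.trans (F.reflexive (cong F.elem e)) rhs))
      where A = tabulateᵛ (index ∘ as)

-- Numerical estimates

^-distribʳ-* : ∀ m n e → (m * n) ^ e ≡ m ^ e * n ^ e
^-distribʳ-* m n zero    = refl
^-distribʳ-* m n (suc e) = trans (cong (m * n *_) (^-distribʳ-* m n e)) (interchange m n (m ^ e) (n ^ e))
  where
  interchange : ∀ a b c d → a * b * (c * d) ≡ a * c * (b * d)
  interchange = solve-∀

n<2^n : ∀ n → suc n ≤ 2 ^ n
n<2^n zero    = ≤-refl
n<2^n (suc n) = begin
  suc (suc n)      ≤⟨ s≤s (m≤n+m (suc n) n) ⟩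
  suc n + suc n    ≤⟨ +-mono-≤ (n<2^n n) (n<2^n n) ⟩
  2 ^ n + 2 ^ n    ≡⟨ cong (2 ^ n +_) (sym (+-identityʳ _)) ⟩
  2 ^ suc n        ∎
  where open ≤-Reasoning

-- As 2 ≤ k, powers of k absorb both 2ⁿ and the linear growth in n: each supplies one factor 2ˡ ≤
-- kˡ. The constant left over is 32, namely 2³ times the 4 of `linear`, within the available 81.
constant-k : ∀ k l e → 2 ≤ k → suc (l + l) ≤ e → 2 ^ (3 + l) * (k + 2 + (3 + l)) ≤ 81 * k ^ e
constant-k k@(suc (suc k′)) l e 2≤k@(s≤s (s≤s _)) 1+2l≤e = begin
  2 ^ (3 + l) * (k + 2 + (3 + l))                   ≤⟨ *-monoʳ-≤ (2 ^ (3 + l)) linear ⟩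
  2 ^ (3 + l) * (4 * 2 ^ l * k)                     ≡⟨ regroup (2 ^ l) k ⟩
  32 * (k * (2 ^ l * 2 ^ l))                        ≤⟨ *-mono-≤ (m≤m+n 32 49) (*-monoʳ-≤ k
                                                         (*-mono-≤ (^-monoˡ-≤ l 2≤k) (^-monoˡ-≤ l 2≤k))) ⟩
  81 * (k * (k ^ l * k ^ l))                        ≡⟨ cong (λ t → 81 * (k * t)) (sym (^-distribˡ-+-* k l l)) ⟩
  81 * k ^ suc (l + l)                              ≤⟨ *-monoʳ-≤ 81 (^-monoʳ-≤ k 1+2l≤e) ⟩
  81 * k ^ e                                        ∎
  where
  open ≤-Reasoning
  regroup : ∀ t k → 2 * (2 * (2 * t)) * (4 * t * k) ≡ 32 * (k * (t * t))
  regroup = solve-∀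
  -- Substituting k = k′ + 2 turns the gap into a polynomial with nonnegative coefficients.
  expand : ∀ k′ l → 4 * suc l * suc (suc k′) ≡ suc (suc k′) + 2 + (3 + l) + (1 + 3 * k′ + 7 * l + 4 * l * k′)
  expand = solve-∀
  linear : k + 2 + (3 + l) ≤ 4 * 2 ^ l * k
  linear = begin
    k + 2 + (3 + l)     ≤⟨ m≤m+n _ _ ⟩
    k + 2 + (3 + l) + (1 + 3 * k′ + 7 * l + 4 * l * k′) ≡⟨ sym (expand k′ l) ⟩
    4 * suc l * k       ≤⟨ *-monoˡ-≤ k (*-monoʳ-≤ 4 (n<2^n l)) ⟩
    4 * 2 ^ l * k       ∎

constant : ∀ k m l q → 2 ≤ k → 2 ≤ m →
  2 ^ (3 + l) * m ^ (3 + l) * (q ^ (3 + l) * (m * (m * (m * q ^ l)) * (k + 2 + (3 + l))))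
  ≤ 81 * (m * k) ^ (2 * ((2 + l) ⊔ 4)) * q ^ (2 * (3 + l) ∸ 3)
constant k m@(suc _) l q 2≤k 2≤m = begin
  2 ^ (3 + l) * m ^ (3 + l) * (q ^ (3 + l) * (m * (m * (m * q ^ l)) * (k + 2 + (3 + l))))
    ≡⟨ regroup (2 ^ (3 + l)) m (m ^ l) (q ^ (3 + l)) (q ^ l) (k + 2 + (3 + l)) ⟩
  2 ^ (3 + l) * (k + 2 + (3 + l)) * m ^ (6 + l) * (q ^ (3 + l) * q ^ l)
    ≤⟨ *-monoˡ-≤ _ (*-mono-≤ (constant-k k l e 2≤k 1+2l≤e) (^-monoʳ-≤ m 6+l≤e)) ⟩
  81 * k ^ e * m ^ e * (q ^ (3 + l) * q ^ l)
    ≡⟨ cong₂ _*_ (trans (*-assoc 81 (k ^ e) (m ^ e)) (cong (81 *_) (trans (*-comm (k ^ e) (m ^ e))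
         (sym (^-distribʳ-* m k e))))) (trans (sym (^-distribˡ-+-* q (3 + l) l)) (cong (q ^_) exponent)) ⟩
  81 * (m * k) ^ e * q ^ (2 * (3 + l) ∸ 3) ∎
  where
  open ≤-Reasoning
  e = 2 * ((2 + l) ⊔ 4)
  regroup : ∀ t m u s v w →
    t * (m * (m * (m * u))) * (s * (m * (m * (m * v)) * w)) ≡
    t * w * (m * (m * (m * (m * (m * (m * u)))))) * (s * v)
  regroup = solve-∀
  4+2l≤e : 4 + (l + l) ≤ e
  4+2l≤e = ≤-trans (≤-reflexive (double l)) (*-monoʳ-≤ 2 (m≤m⊔n (2 + l) 4))
    where
    double : ∀ l → 4 + (l + l) ≡ 2 * (2 + l)
    double = solve-∀
  1+2l≤e : suc (l + l) ≤ e
  1+2l≤e = ≤-trans (m≤n+m (suc (l + l)) 3) 4+2l≤e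
  -- The orbit gives mⁿ and `fibre₃` gives m³. For l ≤ 2 the 4 in the maximum provides the room,
  -- beyond that n - 1 does; n = 5 is the tight case.
  6+l≤e : 6 + l ≤ e
  6+l≤e with ≤-total l 2
  ... | inj₁ l≤2 = ≤-trans (+-monoʳ-≤ 6 l≤2) (*-monoʳ-≤ 2 (m≤n⊔m (2 + l) 4))
  ... | inj₂ 2≤l = ≤-trans (+-monoʳ-≤ 4 (+-monoˡ-≤ l 2≤l)) 4+2l≤e
  exponent : 3 + l + l ≡ 2 * (3 + l) ∸ 3
  exponent = sym (trans (cong (_∸ 3) (double l)) (m+n∸m≡n 3 (3 + l + l)))
    where
    double : ∀ l → 2 * (3 + l) ≡ 3 + (3 + l + l)
    double = solve-∀

-- Passage to integer absolute values and conclusion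

open import Data.Integer using (+_; ∣_∣) renaming (_-_ to _-ℤ_)
open import Data.Integer.Properties using ([+m]-[+n]≡m⊖n; ∣⊖∣-≤; ∣m⊖n∣≡∣n⊖m∣)

∣+-+∣≡∣-∣ : ∀ x y → ∣ (+ x) -ℤ (+ y) ∣ ≡ ∣ x - y ∣
∣+-+∣≡∣-∣ x y with ≤-total x y
... | inj₁ x≤y = trans (cong ∣_∣ ([+m]-[+n]≡m⊖n x y)) (trans (∣⊖∣-≤ x≤y) (sym (m≤n⇒∣m-n∣≡n∸m x≤y)))
... | inj₂ y≤x = trans (cong ∣_∣ ([+m]-[+n]≡m⊖n x y)) (trans (∣m⊖n∣≡∣n⊖m∣ x y)
                   (trans (∣⊖∣-≤ y≤x) (sym (m≤n⇒∣n-m∣≡n∸m y≤x))))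

theorem4p1 : ∀ {c ℓ} (F : FiniteField c ℓ) (k m n : ℕ) →
    2 ≤ k → 2 ≤ m → 3 ≤ n →
    ¬ (FiniteField._≈_ F (FieldOps.natCast F (m * k)) (FiniteField.0# F)) →
    n < m * k →
    (a b : FiniteField.Carrier F) (as : Fin n → FiniteField.Carrier F) →
    ¬ (FiniteField._≈_ F a (FiniteField.0# F)) →
    ¬ (FiniteField._≈_ F b (FiniteField.0# F)) →
    (∀ i → ¬ (FiniteField._≈_ F (as i) (FiniteField.0# F))) →
    let q = FiniteField.q F
        N = FieldOps.numSolutions F n m k a b as
        d = ∣ (+ N) -ℤ (+ (q ^ (n ∸ 1))) ∣
    in d * d ≤ 81 * ((m * k) ^ (2 * ((n ∸ 1) ⊔ 4))) * (q ^ (2 * n ∸ 3))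
-- Matching `n` as 3 + l makes `n ∸ 1` compute to `2 + l`, the exponent of the main term in
-- `deviation-bound`.
theorem4p1 F k@(suc _) m@(suc _) n@(suc (suc (suc l))) 2≤k 2≤m (s≤s (s≤s (s≤s _))) _ _ a b as a≉0 _ as≉0 = begin
  d * d
    ≡⟨ cong (λ t → t * t) (trans (∣+-+∣≡∣-∣ (FieldOps.numSolutions F n m k a b as) (q ^ (2 + l)))
         (cong (λ N → ∣ N - q ^ (2 + l) ∣) (T.numSolutions-N k m a a≉0 n b as))) ⟩
  T.deviation² k m a a≉0 (q ^ (2 + l)) A (T.index b)
    ≤⟨ T.deviation-bound k m a a≉0 l 2≤m A (T.units-tabulate n as as≉0) (T.index b) ⟩
  2 ^ n * m ^ n * (q ^ n * (m * (m * (m * q ^ l)) * (k + 2 + n)))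
    ≤⟨ constant k m l q 2≤k 2≤m ⟩
  81 * (m * k) ^ (2 * ((2 + l) ⊔ 4)) * q ^ (2 * n ∸ 3) ∎
  where
  open ≤-Reasoning
  module T = Transport F
  q = FiniteField.q F
  A = tabulateᵛ (T.index ∘ as)
  d = ∣ (+ FieldOps.numSolutions F n m k a b as) -ℤ (+ (q ^ (2 + l))) ∣
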